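{- Let $G,H\in\mathbb{F}_q[x]$ be nonzero. Let $\bar H$ denote the largest square-free monic divisor of $H$ (the product of the distinct monic irreducible divisors of $H$) and $H^*=H/\bar H$; define $\bar G$ and $G^*=G/\bar G$ likewise. Then $$\frac{\mu(\bar H)\,\eta(GH^*,H)}{|H^*|}=\frac{\mu(\bar G)\,\eta(HG^*,G)}{|G^*|}.$$
   Context: Let $\mathbb{F}_q$ be a finite field with $q$ elements and fix a non-trivial homomorphism $\lambda:(\mathbb{F}_q,+)\to\mathbb{C}^*$. For nonzero $M\in\mathbb{F}_q[x]$ of degree $m\ge1$ and $A\in\mathbb{F}_q[x]$, let $t_M(A)$ be the coefficient of $x^{m-1}$ in the remainder of $A$ on division by $M$ (if $m=0$, $t_M(A)=0$), and $E(G,M)(A)=\lambda(t_M(GA))$. For nonzero $H$, the polynomial Ramanujan sum is $\eta(G,H)=\sum_{D}E(G,H)(D)$, where $D$ runs over a complete residue system modulo $H$ with $\gcd(D,H)=1$. $|A|=q^{\deg A}$. The Möbius function $\mu$ on $\mathbb{F}_q[x]$: $\mu(A)=0$ if $A=0$ or $P^2\mid A$ for some irreducible $P$, otherwise $\mu(A)=(-1)^t$ with $t$ the number of distinct monic irreducible factors of $A$. -}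

module Defs where

open import Data.Bool using (Bool; true; false; if_then_else_; _∧_; not)
open import Data.Nat as ℕ using (ℕ; zero; suc; _∸_; _≡ᵇ_; _<ᵇ_)
open import Data.Integer as ℤ using (ℤ)
open import Data.List using (List; []; _∷_; _++_; [_]; map; foldr; length; null; concatMap; filterᵇ; applyUpTo)
open import Data.Bool.ListAction using (any; all)
open import Data.List.Membership.Propositional using (_∈_)
open import Data.List.Relation.Unary.Unique.Propositional using (Unique)
open import Data.Product using (_×_; _,_; proj₁; proj₂; ∃)
open import Relation.Binary.PropositionalEquality using (_≡_; _≢_)
open import Relation.Binary.Definitions using (DecidableEquality)
open import Relation.Nullary using (does)
open import Algebra.Structures using (IsCommutativeRing)

-- A finite field F_q: a commutative ring (with propositional equality),
-- 0 ≠ 1, every nonzero element invertible (total inverse, 0⁻¹ arbitrary),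
-- decidable equality, and an exhaustive duplicate-free enumeration.
-- q = number of elements = length of the enumeration.

record FiniteField : Set₁ where
  infixl 7 _*_
  infixl 6 _+_
  field
    Carrier  : Set
    _≟_      : DecidableEquality Carrier
    _+_ _*_  : Carrier → Carrier → Carrier
    -_       : Carrier → Carrier
    0# 1#    : Carrier
    _⁻¹      : Carrier → Carrier
    isCommutativeRing : IsCommutativeRing _≡_ _+_ _*_ -_ 0# 1#
    0≢1      : 0# ≢ 1#
    inverseʳ : ∀ x → x ≢ 0# → x * (x ⁻¹) ≡ 1#
    elements : List Carrier
    complete : ∀ x → x ∈ elements
    unique   : Unique elements

  q : ℕ
  q = length elements

-- A field of characteristic zero (stand-in for ℂ),
-- with total inverse (0⁻¹ arbitrary).

natEmbed : {A : Set} → A → A → (A → A → A) → ℕ → A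
natEmbed z o _+_ zero    = z
natEmbed z o _+_ (suc n) = o + natEmbed z o _+_ n

record CharZeroField : Set₁ where
  infixl 7 _*_
  infixl 6 _+_
  field
    Carrier  : Set
    _+_ _*_  : Carrier → Carrier → Carrier
    -_       : Carrier → Carrier
    0# 1#    : Carrier
    _⁻¹      : Carrier → Carrier
    isCommutativeRing : IsCommutativeRing _≡_ _+_ _*_ -_ 0# 1#
    0≢1      : 0# ≢ 1#
    inverseʳ : ∀ x → x ≢ 0# → x * (x ⁻¹) ≡ 1#
    charZero : ∀ n → natEmbed 0# 1# _+_ (suc n) ≢ 0#

  fromℕ : ℕ → Carrier
  fromℕ = natEmbed 0# 1# _+_

  fromℤ : ℤ → Carrier
  fromℤ (ℤ.+ n)      = fromℕ n
  fromℤ (ℤ.-[1+ n ]) = - fromℕ (suc n)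

  -- division by a natural number (nonzero naturals map to nonzero elements)
  _/ℕ_ : Carrier → ℕ → Carrier
  x /ℕ n = x * (fromℕ n ⁻¹)

  sum : List Carrier → Carrier
  sum = foldr _+_ 0#

record AddChar (𝔽 : FiniteField) (𝕂 : CharZeroField) : Set where
  private
    module F = FiniteField 𝔽
    module K = CharZeroField 𝕂
  field
    ψ          : F.Carrier → K.Carrier
    hom        : ∀ a b → ψ (a F.+ b) ≡ ψ a K.* ψ b
    nonzero    : ∀ a → ψ a ≢ K.0#
    nontrivial : ∃ λ a → ψ a ≢ K.1#

-- Polynomials over F_q, represented as coefficient lists, lowest degree
-- first.  A list may have trailing zeros; 'norm' strips them, and all
-- notions below only depend on the polynomial (normal form).

module Poly (𝔽 : FiniteField) where
  open FiniteField 𝔽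

  Pol : Set
  Pol = List Carrier

  isZero : Carrier → Bool
  isZero a = does (a ≟ 0#)

  norm : Pol → Pol
  norm [] = []
  norm (a ∷ as) with norm as
  ... | [] = if isZero a then [] else [ a ]
  ... | r  = a ∷ r

  IsZeroPoly : Pol → Set
  IsZeroPoly A = norm A ≡ []

  deg : Pol → ℕ
  deg A = length (norm A) ∸ 1

  ∣_∣ : Pol → ℕ
  ∣ A ∣ = q ℕ.^ deg A

  lastOr : Pol → Carrier
  lastOr []           = 0#
  lastOr (a ∷ [])     = a
  lastOr (a ∷ b ∷ as) = lastOr (b ∷ as)

  lead : Pol → Carrier
  lead A = lastOr (norm A)

  coeff : ℕ → Pol → Carrier
  coeff i       []       = 0#
  coeff zero    (a ∷ as) = a
  coeff (suc i) (a ∷ as) = coeff i as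

  addL : Pol → Pol → Pol
  addL []       ys       = ys
  addL (x ∷ xs) []       = x ∷ xs
  addL (x ∷ xs) (y ∷ ys) = (x + y) ∷ addL xs ys

  scale : Carrier → Pol → Pol
  scale c = map (c *_)

  mulL : Pol → Pol → Pol
  mulL []       ys = []
  mulL (x ∷ xs) ys = addL (scale x ys) (0# ∷ mulL xs ys)

  _⊕_ : Pol → Pol → Pol
  A ⊕ B = norm (addL A B)

  _⊖_ : Pol → Pol → Pol
  A ⊖ B = norm (addL A (map -_ B))

  _⊗_ : Pol → Pol → Pol
  A ⊗ B = norm (mulL A B)

  one : Pol
  one = [ 1# ]

  -- Euclidean division of A by M (M nonzero), by Horner's scheme from the
  -- top coefficient down; returns (quotient , remainder).
  divModL : Pol → Pol → Pol × Pol
  divModL M A = foldr step ([] , []) A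
    where
      nM = norm M
      m  = length nM
      step : Carrier → Pol × Pol → Pol × Pol
      step c (qt , r) with norm (c ∷ r)
      ... | s = if length s ≡ᵇ m
                  then (let k = lead s * (lead nM ⁻¹) in (k ∷ qt , s ⊖ scale k nM))
                  else (0# ∷ qt , s)

  quot : Pol → Pol → Pol
  quot M A = norm (proj₁ (divModL M A))

  rem : Pol → Pol → Pol
  rem M A = norm (proj₂ (divModL M A))

  divides : Pol → Pol → Bool
  divides M A = null (rem M A)

  -- gcd by the Euclidean algorithm (fuel is sufficient: degrees decrease)
  gcdF : ℕ → Pol → Pol → Pol
  gcdF zero    a b = norm a
  gcdF (suc n) a b = if null (norm b) then norm a else gcdF n b (rem b a)

  gcdP : Pol → Pol → Pol
  gcdP a b = gcdF (suc (length a ℕ.+ length b)) a b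

  -- gcd(A,B) = 1 (i.e. the gcd is a nonzero constant)
  coprime : Pol → Pol → Bool
  coprime A B = length (gcdP A B) ≡ᵇ 1

  -- all coefficient lists of length d: the polynomials of degree < d,
  -- each exactly once
  allOfLength : ℕ → List Pol
  allOfLength zero    = [ [] ]
  allOfLength (suc d) = concatMap (λ c → map (c ∷_) (allOfLength d)) elements

  monicOfDeg : ℕ → List Pol
  monicOfDeg d = map (λ v → v ++ [ 1# ]) (allOfLength d)

  monicOfDeg1to : ℕ → List Pol
  monicOfDeg1to n = concatMap monicOfDeg (applyUpTo suc n)

  irreducible : Pol → Bool
  irreducible P =
    (0 <ᵇ deg P) ∧ all (λ Q → not (divides Q P)) (monicOfDeg1to (deg P ∸ 1))

  monicIrrDivisors : Pol → List Pol
  monicIrrDivisors A =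
    filterᵇ (λ P → irreducible P ∧ divides P A) (monicOfDeg1to (deg A))

  prod : List Pol → Pol
  prod = foldr _⊗_ one

  rad : Pol → Pol
  rad A = prod (monicIrrDivisors A)

  star : Pol → Pol
  star A = quot (rad A) A

  μ : Pol → ℤ
  μ A = if null (norm A) then ℤ.0ℤ
        else if any (λ P → divides (P ⊗ P) A) (monicIrrDivisors A) then ℤ.0ℤ
        else (ℤ.- ℤ.1ℤ) ℤ.^ length (monicIrrDivisors A)

  t : Pol → Pol → Carrier
  t M A = if deg M ≡ᵇ 0 then 0# else coeff (deg M ∸ 1) (rem M A)

module Ramanujan (𝔽 : FiniteField) (𝕂 : CharZeroField) (χ : AddChar 𝔽 𝕂) where
  open Poly 𝔽 public
  private module K = CharZeroField 𝕂
  open AddChar χ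

  E : Pol → Pol → Pol → K.Carrier
  E G M A = ψ (t M (G ⊗ A))

  -- η(G,H) = Σ_{D mod H, gcd(D,H)=1} E(G,H)(D); the residue system is the
  -- set of polynomials of degree < deg H.
  η : Pol → Pol → K.Carrier
  η G H = K.sum (map (E G H) (filterᵇ (λ D → coprime D H) (allOfLength (deg H))))

{-# OPTIONS --safe #-}

-- Write S = H* and L for the monic irreducible divisors of H, so that H = S·∏L.  Sieving the
-- residues D mod H by the primes P ∈ L, one at a time, reduces η(GS, H) to sums of
-- λ(t_H(GSD)) over the multiples D of a divisor C of H.  Orthogonality of characters makes such
-- a sum |H/C| or 0 according to whether H/C divides GS, and reassembling gives
--   η(G H*, H) = |H*| ∏_{P ∣ H} (|P| [P ∣ G] − 1).
-- Since μ(rad H) is the sign (−1)^#L, the left-hand side of the theorem is ∏ (1 − |P|) over the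
-- common monic irreducible divisors of G and H, which is symmetric in G and H.

module Submission where

open import Defs
open import Level using (0ℓ)
open import Algebra.Bundles using (CommutativeRing)
import Algebra.Properties.CommutativeSemigroup as CommutativeSemigroupProperties
import Algebra.Properties.Ring as RingProperties
import Algebra.Solver.Ring.NaturalCoefficients.Default as SemiringSolver
open import Data.Bool using (Bool; true; false; if_then_else_; _∧_; not; T)
open import Data.Bool.ListAction using (all; any)
open import Data.Bool.Properties using (T-∧; T-not-≡; T-≡)
open import Data.Integer as ℤ using (ℤ)
import Data.Integer.Properties as ℤ
open import Data.List using (List; []; _∷_; _++_; [_]; map; foldr; length; null; filterᵇ; applyUpTo; concatMap; replicate)
open import Data.List.Membership.Propositional using (_∈_; find; lose)
open import Data.List.Membership.Propositional.Properties using (∈-concatMap⁺; ∈-concatMap⁻; ∈-map⁺; ∈-map⁻; ∈-applyUpTo⁺; ∈-applyUpTo⁻; ∈-filter⁺; ∈-filter⁻)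
open import Data.List.Membership.Propositional.Properties.WithK using (unique∧set⇒bag)
open import Data.List.Properties using (foldr-cong; length-map; length-replicate; ∷-injectiveˡ; ∷-injectiveʳ; ++-cancelʳ; filter-++; filter-none; applyUpTo-∷ʳ; concatMap-++; ++-identityʳ; map-cong; map-∘)
open import Data.List.Relation.Binary.BagAndSetEquality using (∼bag⇒↭)
open import Data.List.Relation.Binary.Disjoint.Propositional using (Disjoint)
open import Data.List.Relation.Binary.Permutation.Propositional using (_↭_; ↭⇒↭ₛ)
open import Data.List.Relation.Binary.Permutation.Propositional.Properties using (map⁺)
open import Data.List.Relation.Binary.Permutation.Setoid.Properties using (foldr-commMonoid)
open import Data.List.Relation.Unary.All as All using (All; []; _∷_)
import Data.List.Relation.Unary.All.Properties as All
open import Data.List.Relation.Unary.AllPairs as AllPairs using (AllPairs; []; _∷_)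
import Data.List.Relation.Unary.AllPairs.Properties as AllPairs
open import Data.List.Relation.Unary.Any using (here; there)
import Data.List.Relation.Unary.Any.Properties as Any
open import Data.List.Relation.Unary.Unique.Propositional using (Unique)
import Data.List.Relation.Unary.Unique.Propositional.Properties as Unique
open import Data.Nat as ℕ using (ℕ; zero; suc; _∸_; _≤_; _<_; z≤n; s≤s; _≡ᵇ_)
import Data.Nat.Properties as ℕ
open import Data.Product using (_×_; _,_; proj₁; proj₂; ∃; ∃₂)
open import Data.Sum using (_⊎_; inj₁; inj₂)
open import Function.Base using (_∘_)
open import Function.Bundles using (Equivalence; mk⇔)
open import Relation.Binary using (Setoid; IsEquivalence)
open import Relation.Binary.PropositionalEquality hiding ([_])
import Relation.Binary.Reasoning.Setoid as SetoidReasoning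
open import Relation.Nullary using (¬_; Dec; yes; no; contradiction)
open import Relation.Nullary.Decidable using (T?)

-- The twist by `H*` is what makes the sum factor. At the end of the sieve `H = C·N·H*`, where `C`
-- collects the primes forced to divide `D` and `N` the primes on which no condition remains.
-- Orthogonality then asks whether `N·H*` divides `G·H*`, which is the same as `N` dividing `G`: the
-- multiplicities of the primes in `H` cancel, and for the square-free `N` divisibility can be
-- tested prime by prime. This is why the alternating sum over subsets of primes collapses to a
-- product. Coprimality is carried throughout as a Bezout identity, so unique factorisation is never
-- invoked. Since coefficient lists may end in zeros, equality of polynomials is coarser than
-- equality of lists, and reindexing a sum over residues requires a summand that depends only on the
-- polynomial.

module PolynomialRing (𝔽 : FiniteField) where
  open FiniteField 𝔽
  open Poly 𝔽

  -- The commutative ring of coefficient lists up to trailing zeros.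

  fieldRing : CommutativeRing 0ℓ 0ℓ
  fieldRing = record { isCommutativeRing = isCommutativeRing }

  module F where
    open CommutativeRing fieldRing public
    open RingProperties ring public
    open CommutativeSemigroupProperties +-commutativeSemigroup public using (interchange)

  infixl 6 _⊞_
  infixl 7 _⊠_
  infix 4 _≈_

  _⊞_ _⊠_ : Pol → Pol → Pol
  _⊞_ = addL
  _⊠_ = mulL

  ⊟_ : Pol → Pol
  ⊟_ = map -_

  -- Lists that differ by trailing zeros are the same polynomial. A record rather than a bare
  -- function type, so that both sides can be inferred from a proof.
  record _≈_ (A B : Pol) : Set where
    constructor ext
    field at : ∀ i → coeff i A ≡ coeff i B
  open _≈_ public

  ≈-refl : ∀ {A} → A ≈ A
  ≈-refl = ext λ _ → refl

  ≈-sym : ∀ {A B} → A ≈ B → B ≈ A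
  ≈-sym p = ext λ i → sym (at p i)

  ≈-trans : ∀ {A B C} → A ≈ B → B ≈ C → A ≈ C
  ≈-trans p r = ext λ i → trans (at p i) (at r i)

  ≈-reflexive : ∀ {A B} → A ≡ B → A ≈ B
  ≈-reflexive refl = ≈-refl

  ≈-isEquivalence : IsEquivalence _≈_
  ≈-isEquivalence = record { refl = ≈-refl ; sym = ≈-sym ; trans = ≈-trans }

  polSetoid : Setoid 0ℓ 0ℓ
  polSetoid = record { isEquivalence = ≈-isEquivalence }

  module ≈-Reasoning = SetoidReasoning polSetoid

  coeff-⊞ : ∀ i A B → coeff i (A ⊞ B) ≡ coeff i A + coeff i B
  coeff-⊞ i       []      B       = sym (F.+-identityˡ _)
  coeff-⊞ i       (x ∷ A) []      = sym (F.+-identityʳ _)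
  coeff-⊞ zero    (x ∷ A) (y ∷ B) = refl
  coeff-⊞ (suc i) (x ∷ A) (y ∷ B) = coeff-⊞ i A B

  coeff-scale : ∀ i c A → coeff i (scale c A) ≡ c * coeff i A
  coeff-scale i       c []      = sym (F.zeroʳ c)
  coeff-scale zero    c (x ∷ A) = refl
  coeff-scale (suc i) c (x ∷ A) = coeff-scale i c A

  coeff-⊟ : ∀ i A → coeff i (⊟ A) ≡ - coeff i A
  coeff-⊟ i       []      = sym F.-0#≈0#
  coeff-⊟ zero    (x ∷ A) = refl
  coeff-⊟ (suc i) (x ∷ A) = coeff-⊟ i A

  ∷-cong : ∀ {x y A B} → x ≡ y → A ≈ B → x ∷ A ≈ y ∷ B
  ∷-cong p r = ext λ { zero → p ; (suc i) → at r i }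

  0∷[]≈[] : ∀ {A} → A ≈ [] → 0# ∷ A ≈ []
  0∷[]≈[] p = ext λ { zero → refl ; (suc i) → at p i }

  ∷-injective : ∀ {x y A B} → x ∷ A ≈ y ∷ B → x ≡ y × A ≈ B
  ∷-injective p = at p 0 , ext λ i → at p (suc i)

  ⊞-cong : ∀ {A A′ B B′} → A ≈ A′ → B ≈ B′ → A ⊞ B ≈ A′ ⊞ B′
  ⊞-cong {A} {A′} {B} {B′} p r = ext λ i →
    trans (coeff-⊞ i A B) (trans (cong₂ _+_ (at p i) (at r i)) (sym (coeff-⊞ i A′ B′)))

  ⊞-assoc : ∀ A B C → (A ⊞ B) ⊞ C ≈ A ⊞ (B ⊞ C)
  ⊞-assoc A B C = ext λ i → begin
    coeff i (A ⊞ B ⊞ C)                 ≡⟨ coeff-⊞ i (A ⊞ B) C ⟩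
    coeff i (A ⊞ B) + coeff i C         ≡⟨ cong (_+ coeff i C) (coeff-⊞ i A B) ⟩
    coeff i A + coeff i B + coeff i C   ≡⟨ F.+-assoc _ _ _ ⟩
    coeff i A + (coeff i B + coeff i C) ≡⟨ cong (coeff i A +_) (coeff-⊞ i B C) ⟨
    coeff i A + coeff i (B ⊞ C)         ≡⟨ coeff-⊞ i A (B ⊞ C) ⟨
    coeff i (A ⊞ (B ⊞ C))               ∎
    where open ≡-Reasoning

  ⊞-comm : ∀ A B → A ⊞ B ≈ B ⊞ A
  ⊞-comm A B = ext λ i →
    trans (coeff-⊞ i A B) (trans (F.+-comm _ _) (sym (coeff-⊞ i B A)))

  ⊞-identityˡ : ∀ A → [] ⊞ A ≈ A
  ⊞-identityˡ A = ≈-refl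

  ⊞-identityʳ : ∀ A → A ⊞ [] ≈ A
  ⊞-identityʳ A = ⊞-comm A []

  ⊟-cong : ∀ {A B} → A ≈ B → ⊟ A ≈ ⊟ B
  ⊟-cong {A} {B} p = ext λ i → trans (coeff-⊟ i A) (trans (cong -_ (at p i)) (sym (coeff-⊟ i B)))

  ⊟-inverseʳ : ∀ A → A ⊞ ⊟ A ≈ []
  ⊟-inverseʳ A = ext λ i →
    trans (coeff-⊞ i A (⊟ A)) (trans (cong (coeff i A +_) (coeff-⊟ i A)) (F.-‿inverseʳ _))

  ⊟-inverseˡ : ∀ A → ⊟ A ⊞ A ≈ []
  ⊟-inverseˡ A = ≈-trans (⊞-comm (⊟ A) A) (⊟-inverseʳ A)

  ⊞-interchange : ∀ A B C D → (A ⊞ B) ⊞ (C ⊞ D) ≈ (A ⊞ C) ⊞ (B ⊞ D)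
  ⊞-interchange A B C D = ext λ i → begin
    coeff i (A ⊞ B ⊞ (C ⊞ D))                         ≡⟨ lemma i A B C D ⟩
    coeff i A + coeff i B + (coeff i C + coeff i D)   ≡⟨ F.interchange _ _ _ _ ⟩
    coeff i A + coeff i C + (coeff i B + coeff i D)   ≡⟨ lemma i A C B D ⟨
    coeff i (A ⊞ C ⊞ (B ⊞ D))                         ∎
    where
    open ≡-Reasoning
    lemma : ∀ i A B C D →
      coeff i (A ⊞ B ⊞ (C ⊞ D)) ≡ coeff i A + coeff i B + (coeff i C + coeff i D)
    lemma i A B C D =
      trans (coeff-⊞ i (A ⊞ B) (C ⊞ D)) (cong₂ _+_ (coeff-⊞ i A B) (coeff-⊞ i C D))

  scale-cong : ∀ {c d A B} → c ≡ d → A ≈ B → scale c A ≈ scale d B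
  scale-cong {c} {d} {A} {B} e p = ext λ i →
    trans (coeff-scale i c A) (trans (cong₂ _*_ e (at p i)) (sym (coeff-scale i d B)))

  scale-⊞ : ∀ c A B → scale c (A ⊞ B) ≈ scale c A ⊞ scale c B
  scale-⊞ c A B = ext λ i → begin
    coeff i (scale c (A ⊞ B))                 ≡⟨ coeff-scale i c (A ⊞ B) ⟩
    c * coeff i (A ⊞ B)                       ≡⟨ cong (c *_) (coeff-⊞ i A B) ⟩
    c * (coeff i A + coeff i B)               ≡⟨ F.distribˡ _ _ _ ⟩
    c * coeff i A + c * coeff i B             ≡⟨ cong₂ _+_ (coeff-scale i c A) (coeff-scale i c B) ⟨
    coeff i (scale c A) + coeff i (scale c B) ≡⟨ coeff-⊞ i (scale c A) (scale c B) ⟨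
    coeff i (scale c A ⊞ scale c B)           ∎
    where open ≡-Reasoning

  scale-scale : ∀ c d A → scale c (scale d A) ≈ scale (c * d) A
  scale-scale c d A = ext λ i → begin
    coeff i (scale c (scale d A)) ≡⟨ coeff-scale i c (scale d A) ⟩
    c * coeff i (scale d A)       ≡⟨ cong (c *_) (coeff-scale i d A) ⟩
    c * (d * coeff i A)           ≡⟨ F.*-assoc _ _ _ ⟨
    c * d * coeff i A             ≡⟨ coeff-scale i (c * d) A ⟨
    coeff i (scale (c * d) A)     ∎
    where open ≡-Reasoning

  scale-0 : ∀ A → scale 0# A ≈ []
  scale-0 A = ext λ i → trans (coeff-scale i 0# A) (F.zeroˡ _)

  scale-1 : ∀ A → scale 1# A ≈ A
  scale-1 A = ext λ i → trans (coeff-scale i 1# A) (F.*-identityˡ _)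

  0∷-⊞ : ∀ A B → 0# ∷ (A ⊞ B) ≈ (0# ∷ A) ⊞ (0# ∷ B)
  0∷-⊞ A B = ∷-cong (sym (F.+-identityˡ 0#)) ≈-refl

  scale-0∷ : ∀ c A → scale c (0# ∷ A) ≈ 0# ∷ scale c A
  scale-0∷ c A = ∷-cong (F.zeroʳ c) ≈-refl

  ⊠-zeroʳ : ∀ A → A ⊠ [] ≈ []
  ⊠-zeroʳ []      = ≈-refl
  ⊠-zeroʳ (x ∷ A) = 0∷[]≈[] (⊠-zeroʳ A)

  ⊠-congʳ : ∀ A {B B′} → B ≈ B′ → A ⊠ B ≈ A ⊠ B′
  ⊠-congʳ []      p = ≈-refl
  ⊠-congʳ (x ∷ A) p = ⊞-cong (scale-cong refl p) (∷-cong refl (⊠-congʳ A p))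

  ⊠-distribˡ : ∀ A B C → A ⊠ (B ⊞ C) ≈ A ⊠ B ⊞ A ⊠ C
  ⊠-distribˡ []      B C = ≈-refl
  ⊠-distribˡ (x ∷ A) B C = begin
    scale x (B ⊞ C) ⊞ (0# ∷ A ⊠ (B ⊞ C))
      ≈⟨ ⊞-cong (scale-⊞ x B C) (∷-cong refl (⊠-distribˡ A B C)) ⟩
    (scale x B ⊞ scale x C) ⊞ (0# ∷ (A ⊠ B ⊞ A ⊠ C))
      ≈⟨ ⊞-cong ≈-refl (0∷-⊞ (A ⊠ B) (A ⊠ C)) ⟩
    (scale x B ⊞ scale x C) ⊞ ((0# ∷ A ⊠ B) ⊞ (0# ∷ A ⊠ C))
      ≈⟨ ⊞-interchange (scale x B) (scale x C) (0# ∷ A ⊠ B) (0# ∷ A ⊠ C) ⟩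
    (x ∷ A) ⊠ B ⊞ (x ∷ A) ⊠ C ∎
    where open ≈-Reasoning

  -- `mulL` recurses on its left factor. The matching recursion on the right factor makes
  -- commutativity an induction; congruence in the left factor and right distributivity are then
  -- carried over by commutativity.
  ⊠-∷ʳ : ∀ A y B → A ⊠ (y ∷ B) ≈ scale y A ⊞ (0# ∷ A ⊠ B)
  ⊠-∷ʳ []      y B = ≈-sym (0∷[]≈[] ≈-refl)
  ⊠-∷ʳ (x ∷ A) y B = ∷-cong (cong (_+ 0#) (F.*-comm x y)) (begin
    scale x B ⊞ A ⊠ (y ∷ B)                 ≈⟨ ⊞-cong ≈-refl (⊠-∷ʳ A y B) ⟩
    scale x B ⊞ (scale y A ⊞ (0# ∷ A ⊠ B))  ≈⟨ ⊞-assoc (scale x B) (scale y A) _ ⟨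
    scale x B ⊞ scale y A ⊞ (0# ∷ A ⊠ B)    ≈⟨ ⊞-cong (⊞-comm (scale x B) (scale y A)) ≈-refl ⟩
    scale y A ⊞ scale x B ⊞ (0# ∷ A ⊠ B)    ≈⟨ ⊞-assoc (scale y A) (scale x B) _ ⟩
    scale y A ⊞ (x ∷ A) ⊠ B                 ∎)
    where open ≈-Reasoning

  ⊠-comm : ∀ A B → A ⊠ B ≈ B ⊠ A
  ⊠-comm []      B = ≈-sym (⊠-zeroʳ B)
  ⊠-comm (x ∷ A) B =
    ≈-trans (⊞-cong ≈-refl (∷-cong refl (⊠-comm A B))) (≈-sym (⊠-∷ʳ B x A))

  ⊠-cong : ∀ {A A′ B B′} → A ≈ A′ → B ≈ B′ → A ⊠ B ≈ A′ ⊠ B′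
  ⊠-cong {A} {A′} {B} {B′} p r =
    ≈-trans (⊠-congʳ A r) (≈-trans (⊠-comm A B′) (≈-trans (⊠-congʳ B′ p) (⊠-comm B′ A′)))

  ⊠-distribʳ : ∀ A B C → (B ⊞ C) ⊠ A ≈ B ⊠ A ⊞ C ⊠ A
  ⊠-distribʳ A B C =
    ≈-trans (⊠-comm (B ⊞ C) A)
      (≈-trans (⊠-distribˡ A B C) (⊞-cong (⊠-comm A B) (⊠-comm A C)))

  scale-⊠ : ∀ c A B → scale c A ⊠ B ≈ scale c (A ⊠ B)
  scale-⊠ c []      B = ≈-refl
  scale-⊠ c (x ∷ A) B = begin
    scale (c * x) B ⊞ (0# ∷ scale c A ⊠ B)
      ≈⟨ ⊞-cong (≈-sym (scale-scale c x B)) (∷-cong refl (scale-⊠ c A B)) ⟩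
    scale c (scale x B) ⊞ (0# ∷ scale c (A ⊠ B))
      ≈⟨ ⊞-cong ≈-refl (≈-sym (scale-0∷ c (A ⊠ B))) ⟩
    scale c (scale x B) ⊞ scale c (0# ∷ A ⊠ B)
      ≈⟨ scale-⊞ c (scale x B) (0# ∷ A ⊠ B) ⟨
    scale c ((x ∷ A) ⊠ B) ∎
    where open ≈-Reasoning

  0∷-⊠ : ∀ A B → (0# ∷ A) ⊠ B ≈ 0# ∷ A ⊠ B
  0∷-⊠ A B = ⊞-cong (scale-0 B) ≈-refl

  ⊠-assoc : ∀ A B C → (A ⊠ B) ⊠ C ≈ A ⊠ (B ⊠ C)
  ⊠-assoc []      B C = ≈-refl
  ⊠-assoc (x ∷ A) B C = begin
    (scale x B ⊞ (0# ∷ A ⊠ B)) ⊠ C         ≈⟨ ⊠-distribʳ C (scale x B) (0# ∷ A ⊠ B) ⟩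
    scale x B ⊠ C ⊞ (0# ∷ A ⊠ B) ⊠ C       ≈⟨ ⊞-cong (scale-⊠ x B C) (0∷-⊠ (A ⊠ B) C) ⟩
    scale x (B ⊠ C) ⊞ (0# ∷ A ⊠ B ⊠ C)     ≈⟨ ⊞-cong ≈-refl (∷-cong refl (⊠-assoc A B C)) ⟩
    (x ∷ A) ⊠ (B ⊠ C)                      ∎
    where open ≈-Reasoning

  ⊠-identityˡ : ∀ A → one ⊠ A ≈ A
  ⊠-identityˡ A = ≈-trans (⊞-cong (scale-1 A) (0∷[]≈[] ≈-refl)) (⊞-identityʳ A)

  ⊠-identityʳ : ∀ A → A ⊠ one ≈ A
  ⊠-identityʳ A = ≈-trans (⊠-comm A one) (⊠-identityˡ A)

  polynomialRing : CommutativeRing 0ℓ 0ℓ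
  polynomialRing = record
    { Carrier = Pol ; _≈_ = _≈_ ; _+_ = _⊞_ ; _*_ = _⊠_ ; -_ = ⊟_ ; 0# = [] ; 1# = one
    ; isCommutativeRing = record
      { isRing = record
        { +-isAbelianGroup = record
          { isGroup = record
            { isMonoid = record
              { isSemigroup = record
                { isMagma = record { isEquivalence = ≈-isEquivalence ; ∙-cong = ⊞-cong }
                ; assoc = ⊞-assoc }
              ; identity = ⊞-identityˡ , ⊞-identityʳ }
            ; inverse = ⊟-inverseˡ , ⊟-inverseʳ
            ; ⁻¹-cong = ⊟-cong }
          ; comm = ⊞-comm }
        ; *-cong = ⊠-cong
        ; *-assoc = ⊠-assoc
        ; *-identity = ⊠-identityˡ , ⊠-identityʳ
        ; distrib = ⊠-distribˡ , ⊠-distribʳ }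
      ; *-comm = ⊠-comm } }

-- Degrees, absence of zero divisors, and division with remainder.

module EuclideanDivision (𝔽 : FiniteField) where
  open FiniteField 𝔽
  open Poly 𝔽
  open PolynomialRing 𝔽

  module P = CommutativeRing polynomialRing
  open SemiringSolver P.commutativeSemiring using (solve; _:=_; _:+_; _:*_)

  *-nonzero : ∀ {x y} → x ≢ 0# → y ≢ 0# → x * y ≢ 0#
  *-nonzero {x} {y} x≢0 y≢0 xy≡0 = y≢0 (begin
    y               ≡⟨ F.*-identityˡ y ⟨
    1# * y          ≡⟨ cong (_* y) (inverseʳ x x≢0) ⟨
    x * x ⁻¹ * y    ≡⟨ cong (_* y) (F.*-comm x (x ⁻¹)) ⟩
    x ⁻¹ * x * y    ≡⟨ F.*-assoc _ _ _ ⟩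
    x ⁻¹ * (x * y)  ≡⟨ cong (x ⁻¹ *_) xy≡0 ⟩
    x ⁻¹ * 0#       ≡⟨ F.zeroʳ _ ⟩
    0#              ∎)
    where open ≡-Reasoning

  norm-≈ : ∀ A → norm A ≈ A
  norm-≈ [] = ≈-refl
  norm-≈ (a ∷ A) with norm A | norm-≈ A
  ... | x ∷ r | p = ∷-cong refl p
  ... | []    | p with a ≟ 0#
  ...   | yes a≡0 = ≈-sym (≈-trans (∷-cong a≡0 (≈-sym p)) (0∷[]≈[] ≈-refl))
  ...   | no  _   = ∷-cong refl p

  norm-zero : ∀ A → A ≈ [] → norm A ≡ []
  norm-zero [] p = refl
  norm-zero (a ∷ A) p rewrite norm-zero A (ext λ i → at p (suc i)) with a ≟ 0#
  ... | yes _   = refl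
  ... | no  a≢0 = contradiction (at p 0) a≢0

  -- Normal forms are canonical, which is what lets notions computed from `norm`, such as `deg`,
  -- pass to polynomials modulo `_≈_`.
  norm-cong : ∀ A B → A ≈ B → norm A ≡ norm B
  norm-cong []      B       p = sym (norm-zero B (≈-sym p))
  norm-cong (a ∷ A) []      p = norm-zero (a ∷ A) p
  norm-cong (a ∷ A) (b ∷ B) p with ∷-injective p
  ... | refl , A≈B rewrite norm-cong A B A≈B = refl

  norm-idem : ∀ A → norm (norm A) ≡ norm A
  norm-idem A = norm-cong (norm A) A (norm-≈ A)

  norm≡[]⇒≈[] : ∀ {A} → norm A ≡ [] → A ≈ []
  norm≡[]⇒≈[] {A} p = ≈-trans (≈-sym (norm-≈ A)) (≈-reflexive p)

  _≈[]? : ∀ A → Dec (A ≈ [])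
  A ≈[]? with norm A in eq
  ... | []    = yes (norm≡[]⇒≈[] eq)
  ... | _ ∷ _ = no λ p → contradiction (trans (sym (norm-zero A p)) eq) λ ()

  null-norm : ∀ {A} → null (norm A) ≡ true → A ≈ []
  null-norm {A} p with norm A in eq
  ... | [] = norm≡[]⇒≈[] eq

  -- A strict degree bound phrased through coefficients: it is invariant under `_≈_`, needs no
  -- normal form, and covers the zero polynomial without a convention.
  record Below (n : ℕ) (A : Pol) : Set where
    constructor below
    field vanish : ∀ i → n ≤ i → coeff i A ≡ 0#
  open Below public

  -- Unlike an equation `deg A ≡ n`, this excludes the zero polynomial, to which `deg` assigns 0
  -- just as to nonzero constants.
  record Degree (n : ℕ) (A : Pol) : Set where
    constructor _,_
    field
      bounded : Below (suc n) A
      leading : coeff n A ≢ 0#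
  open Degree public

  record Division (A M Q R : Pol) : Set where
    constructor _,_
    field
      equation : A ≈ Q ⊠ M ⊞ R
      small    : Below (deg M) R
  open Division public

  Below-resp : ∀ {n A B} → A ≈ B → Below n A → Below n B
  Below-resp p (below b) = below λ i n≤i → trans (sym (at p i)) (b i n≤i)

  Below-mono : ∀ {m n A} → m ≤ n → Below m A → Below n A
  Below-mono m≤n (below b) = below λ i n≤i → b i (ℕ.≤-trans m≤n n≤i)

  Below-⊞ : ∀ {n A B} → Below n A → Below n B → Below n (A ⊞ B)
  Below-⊞ {A = A} {B} (below a) (below b) = below λ i n≤i →
    trans (coeff-⊞ i A B) (trans (cong₂ _+_ (a i n≤i) (b i n≤i)) (F.+-identityˡ 0#))

  Below-∷ : ∀ {n} c {A} → Below n A → Below (suc n) (c ∷ A)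
  Below-∷ c (below b) = below λ { (suc i) (s≤s n≤i) → b i n≤i }

  Below-tail : ∀ {n c A} → Below (suc n) (c ∷ A) → Below n A
  Below-tail (below b) = below λ i n≤i → b (suc i) (s≤s n≤i)

  Below-[] : ∀ {n} → Below n []
  Below-[] = below λ _ _ → refl

  Below-length : ∀ A → Below (length A) A
  Below-length []      = Below-[]
  Below-length (x ∷ A) = Below-∷ x (Below-length A)

  Below-zero : ∀ {A} → Below 0 A → A ≈ []
  Below-zero (below b) = ext λ i → b i z≤n

  Below-norm : ∀ A → Below (length (norm A)) A
  Below-norm A = Below-resp (norm-≈ A) (Below-length (norm A))

  lastOr-coeff : ∀ A → lastOr A ≡ coeff (length A ∸ 1) A
  lastOr-coeff []          = refl
  lastOr-coeff (x ∷ [])    = refl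
  lastOr-coeff (x ∷ y ∷ A) = lastOr-coeff (y ∷ A)

  lead-coeff : ∀ A → lead A ≡ coeff (deg A) A
  lead-coeff A = trans (lastOr-coeff (norm A)) (at (norm-≈ A) (deg A))

  lastOr-norm : ∀ A → norm A ≢ [] → lastOr (norm A) ≢ 0#
  lastOr-norm [] p = contradiction refl p
  lastOr-norm (a ∷ A) p with norm A | lastOr-norm A
  ... | x ∷ r | ih = ih λ ()
  ... | []    | _ with a ≟ 0#
  ...   | yes _   = contradiction refl p
  ...   | no  a≢0 = a≢0

  lead≢0 : ∀ {A} → ¬ A ≈ [] → lead A ≢ 0#
  lead≢0 {A} A≉0 = lastOr-norm A λ p → A≉0 (norm≡[]⇒≈[] p)

  length-norm : ∀ {A} → ¬ A ≈ [] → length (norm A) ≡ suc (deg A)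
  length-norm {A} A≉0 with norm A in eq
  ... | []    = contradiction (norm≡[]⇒≈[] eq) A≉0
  ... | _ ∷ _ = refl

  degree : ∀ {A} → ¬ A ≈ [] → Degree (deg A) A
  degree {A} A≉0 =
    subst (λ n → Below n A) (length-norm A≉0) (Below-norm A) ,
    λ p → lead≢0 A≉0 (trans (lead-coeff A) p)

  Degree⇒≉0 : ∀ {n A} → Degree n A → ¬ A ≈ []
  Degree⇒≉0 {n} (_ , c) p = c (at p n)

  Below⇒< : ∀ {m n A} → Below m A → coeff n A ≢ 0# → n < m
  Below⇒< {m} {n} (below b) c with m ℕ.≤? n
  ... | yes m≤n = contradiction (b n m≤n) c
  ... | no  m≰n = ℕ.≰⇒> m≰n

  Degree-unique : ∀ {m n A} → Degree m A → Degree n A → m ≡ n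
  Degree-unique (b , c) (b′ , c′) = ℕ.≤-antisym (ℕ.≤-pred (Below⇒< b′ c)) (ℕ.≤-pred (Below⇒< b c′))

  Degree⇒deg : ∀ {n A} → Degree n A → deg A ≡ n
  Degree⇒deg d = Degree-unique (degree (Degree⇒≉0 d)) d

  deg-cong : ∀ A B → A ≈ B → deg A ≡ deg B
  deg-cong A B p = cong (λ r → length r ∸ 1) (norm-cong A B p)

  Below⇒length : ∀ {n A} → Below n A → length (norm A) ≤ n
  Below⇒length {n} {A} b with A ≈[]?
  ... | yes p rewrite norm-zero A p = z≤n
  ... | no A≉0 rewrite length-norm A≉0 = Below⇒< b (leading (degree A≉0))

  -- The asymmetric bounds avoid subtraction: a strict bound on one factor and a weak one on the
  -- other add up to a strict bound on the product.
  Below-⊠ : ∀ {m n} A B → Below m A → Below (suc n) B → Below (m ℕ.+ n) (A ⊠ B)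
  Below-⊠         []      B a b = Below-[]
  Below-⊠ {zero}  (x ∷ A) B a b =
    Below-resp (≈-sym (⊠-cong {x ∷ A} {[]} {B} (Below-zero a) ≈-refl)) Below-[]
  Below-⊠ {suc m} {n} (x ∷ A) B a b = Below-⊞ {A = scale x B}
    (below λ { (suc i) (s≤s p) → trans (coeff-scale (suc i) x B)
      (trans (cong (x *_) (vanish b (suc i) (s≤s (ℕ.≤-trans (ℕ.m≤n+m n m) p)))) (F.zeroʳ x)) })
    (Below-∷ 0# (Below-⊠ A B (Below-tail a) b))

  coeff-⊠ : ∀ m n A B → Below (suc m) A → Below (suc n) B →
            coeff (m ℕ.+ n) (A ⊠ B) ≡ coeff m A * coeff n B
  coeff-⊠ m n [] B a b = sym (F.zeroˡ _)
  coeff-⊠ zero n (x ∷ A) B a b = begin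
    coeff n (scale x B ⊞ (0# ∷ A ⊠ B)) ≡⟨ at (⊞-cong {scale x B} ≈-refl 0∷A⊠B≈[]) n ⟩
    coeff n (scale x B ⊞ [])           ≡⟨ at (⊞-identityʳ (scale x B)) n ⟩
    coeff n (scale x B)                ≡⟨ coeff-scale n x B ⟩
    x * coeff n B                      ∎
    where
    open ≡-Reasoning
    0∷A⊠B≈[] : 0# ∷ A ⊠ B ≈ []
    0∷A⊠B≈[] = 0∷[]≈[] (⊠-cong {A} {[]} {B} (Below-zero (Below-tail a)) ≈-refl)
  coeff-⊠ (suc m) n (x ∷ A) B a b = begin
    coeff (suc m ℕ.+ n) (scale x B ⊞ (0# ∷ A ⊠ B))
      ≡⟨ coeff-⊞ (suc m ℕ.+ n) (scale x B) (0# ∷ A ⊠ B) ⟩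
    coeff (suc m ℕ.+ n) (scale x B) + coeff (m ℕ.+ n) (A ⊠ B)
      ≡⟨ cong₂ _+_ scaled≡0 (coeff-⊠ m n A B (Below-tail a) b) ⟩
    0# + coeff m A * coeff n B
      ≡⟨ F.+-identityˡ _ ⟩
    coeff m A * coeff n B ∎
    where
    open ≡-Reasoning
    scaled≡0 : coeff (suc m ℕ.+ n) (scale x B) ≡ 0#
    scaled≡0 = trans (coeff-scale (suc m ℕ.+ n) x B)
      (trans (cong (x *_) (vanish b (suc m ℕ.+ n) (s≤s (ℕ.m≤n+m n m)))) (F.zeroʳ x))

  Degree-⊠ : ∀ {m n} A B → Degree m A → Degree n B → Degree (m ℕ.+ n) (A ⊠ B)
  Degree-⊠ {m} {n} A B (a , a≢0) (b , b≢0) =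
    Below-⊠ A B a b ,
    λ p → *-nonzero a≢0 b≢0 (trans (sym (coeff-⊠ m n A B a b)) p)

  ⊠-nonzero : ∀ {A B} → ¬ A ≈ [] → ¬ B ≈ [] → ¬ A ⊠ B ≈ []
  ⊠-nonzero {A} {B} A≉0 B≉0 = Degree⇒≉0 (Degree-⊠ A B (degree A≉0) (degree B≉0))

  deg-⊠ : ∀ {A B} → ¬ A ≈ [] → ¬ B ≈ [] → deg (A ⊠ B) ≡ deg A ℕ.+ deg B
  deg-⊠ {A} {B} A≉0 B≉0 = Degree⇒deg (Degree-⊠ A B (degree A≉0) (degree B≉0))

  factorˡ-nonzero : ∀ {A B C} → A ⊠ B ≈ C → ¬ C ≈ [] → ¬ A ≈ []
  factorˡ-nonzero {A} {B} p C≉0 q = C≉0 (≈-trans (≈-sym p) (⊠-cong {A} {[]} {B} q ≈-refl))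

  factorʳ-nonzero : ∀ {A B C} → A ⊠ B ≈ C → ¬ C ≈ [] → ¬ B ≈ []
  factorʳ-nonzero {A} {B} p C≉0 q =
    C≉0 (≈-trans (≈-sym p) (≈-trans (⊠-congʳ A q) (⊠-zeroʳ A)))

  one-degree : Degree 0 one
  one-degree = Below-length one , λ p → 0≢1 (sym p)

  one≉0 : ¬ one ≈ []
  one≉0 = Degree⇒≉0 one-degree

  ⊟-cancel : ∀ {A B} → A ⊞ ⊟ B ≈ [] → A ≈ B
  ⊟-cancel {A} {B} p = begin
    A              ≈⟨ ⊞-identityʳ A ⟨
    A ⊞ []         ≈⟨ ⊞-cong {A} ≈-refl (⊟-inverseˡ B) ⟨
    A ⊞ (⊟ B ⊞ B)  ≈⟨ ⊞-assoc A (⊟ B) B ⟨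
    A ⊞ ⊟ B ⊞ B    ≈⟨ ⊞-cong p ≈-refl ⟩
    B              ∎
    where open ≈-Reasoning

  -- The difference quotient is formed additively, so that only semiring identities are needed.
  division-difference : ∀ {A M Q R Q′ R′} → A ≈ Q ⊠ M ⊞ R → A ≈ Q′ ⊠ M ⊞ R′ →
                        (Q ⊞ ⊟ Q′) ⊠ M ⊞ R ≈ R′
  division-difference {A} {M} {Q} {R} {Q′} {R′} p p′ = begin
    (Q ⊞ ⊟ Q′) ⊠ M ⊞ R        ≈⟨ solve 4 (λ q n m r → (q :+ n) :* m :+ r := (q :* m :+ r) :+ n :* m) ≈-refl Q (⊟ Q′) M R ⟩
    (Q ⊠ M ⊞ R) ⊞ ⊟ Q′ ⊠ M    ≈⟨ ⊞-cong (≈-trans (≈-sym p) p′) ≈-refl ⟩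
    (Q′ ⊠ M ⊞ R′) ⊞ ⊟ Q′ ⊠ M  ≈⟨ solve 4 (λ q n m r → (q :* m :+ r) :+ n :* m := (q :+ n) :* m :+ r) ≈-refl Q′ (⊟ Q′) M R′ ⟩
    (Q′ ⊞ ⊟ Q′) ⊠ M ⊞ R′      ≈⟨ ⊞-cong (⊠-cong {B = M} (⊟-inverseʳ Q′) ≈-refl) ≈-refl ⟩
    R′                        ∎
    where open ≈-Reasoning

  -- If the quotients differed, `(Q - Q′) M` would have degree at least `deg M`, yet it equals the
  -- difference of two remainders.
  division-unique : ∀ {A M Q R Q′ R′} → ¬ M ≈ [] → Division A M Q R → Division A M Q′ R′ →
                    Q ≈ Q′ × R ≈ R′
  division-unique {A} {M} {Q} {R} {Q′} {R′} M≉0 (p , r) (p′ , r′) with (Q ⊞ ⊟ Q′) ≈[]?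
  ... | yes q = ⊟-cancel q ,
    ≈-trans (≈-sym (⊞-cong {A′ = []} (⊠-cong {B = M} q ≈-refl) ≈-refl)) (division-difference {Q = Q} {R} {Q′} p p′)
  ... | no  q = contradiction (Below⇒< ZM<m (leading deg-ZM)) (ℕ.≤⇒≯ (ℕ.m≤n+m (deg M) (deg Z)))
    where
    Z : Pol
    Z = Q ⊞ ⊟ Q′
    deg-ZM : Degree (deg Z ℕ.+ deg M) (Z ⊠ M)
    deg-ZM = Degree-⊠ Z M (degree q) (degree M≉0)
    ZM<m : Below (deg M) (Z ⊠ M)
    ZM<m = below λ i le → begin
      coeff i (Z ⊠ M)             ≡⟨ F.+-identityʳ _ ⟨
      coeff i (Z ⊠ M) + 0#        ≡⟨ cong (coeff i (Z ⊠ M) +_) (vanish r i le) ⟨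
      coeff i (Z ⊠ M) + coeff i R ≡⟨ coeff-⊞ i (Z ⊠ M) R ⟨
      coeff i (Z ⊠ M ⊞ R)         ≡⟨ at (division-difference {Q = Q} {R} {Q′} p p′) i ⟩
      coeff i R′                  ≡⟨ vanish r′ i le ⟩
      0#                          ∎
      where open ≡-Reasoning

  -- Both sides are read as divisions by `M` with remainder zero; cancellation is uniqueness of the
  -- quotient.
  ⊠-cancelʳ : ∀ {A B} M → ¬ M ≈ [] → A ⊠ M ≈ B ⊠ M → A ≈ B
  ⊠-cancelʳ {A} {B} M M≉0 p =
    proj₁ (division-unique {R = []} {R′ = []} M≉0
      (≈-sym (⊞-identityʳ (A ⊠ M)) , Below-[]) (≈-trans p (≈-sym (⊞-identityʳ (B ⊠ M))) , Below-[]))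

  -- A nameable copy of the local step of `divModL`, so that an induction over the dividend can
  -- speak about it; the two agree by computation.
  divisionStep : Pol → Carrier → Pol × Pol → Pol × Pol
  divisionStep M c (qt , r) =
    if length (norm (c ∷ r)) ≡ᵇ length (norm M)
    then (lead (norm (c ∷ r)) * (lead (norm M) ⁻¹) ∷ qt ,
          norm (c ∷ r) ⊖ scale (lead (norm (c ∷ r)) * (lead (norm M) ⁻¹)) (norm M))
    else (0# ∷ qt , norm (c ∷ r))

  divModL≡foldr : ∀ M A → divModL M A ≡ foldr (divisionStep M) ([] , []) A
  divModL≡foldr M A = foldr-cong (λ _ _ → refl) refl A

  module _ {M : Pol} (M≉0 : ¬ M ≈ []) where

    private
      m = deg M

    divisionStep-correct : ∀ c A qt r → Division A M qt r →
      let qt′ , r′ = divisionStep M c (qt , r) in Division (c ∷ A) M qt′ r′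
    divisionStep-correct c A qt r (A≈ , r<m) with length (norm (c ∷ r)) ≡ᵇ length (norm M) in eq
    ... | false = ≈-trans c∷A≈ (⊞-cong {0# ∷ qt ⊠ M} (≈-sym (0∷-⊠ qt M)) (≈-sym s≈)) , s<m
      where
      s = norm (c ∷ r)
      s≈ : s ≈ c ∷ r
      s≈ = norm-≈ (c ∷ r)
      c∷A≈ : c ∷ A ≈ (0# ∷ qt ⊠ M) ⊞ (c ∷ r)
      c∷A≈ = ∷-cong (sym (F.+-identityˡ c)) A≈
      s<m : Below m s
      -- `c ∷ r` has at most `suc m` significant coefficients because `r` has at most `m`; the
      -- failed length test excludes `suc m` itself.
      s<m = Below-mono
        (ℕ.≤-pred (ℕ.≤∧≢⇒< (Below⇒length (Below-∷ c r<m))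
          λ e → subst T eq (ℕ.≡⇒≡ᵇ _ _ (trans e (sym (length-norm M≉0))))))
        (Below-length s)
    ... | true = division-equation , R<m
      where
      s = norm (c ∷ r)
      k = lead s * (lead (norm M) ⁻¹)
      s≈ : s ≈ c ∷ r
      s≈ = norm-≈ (c ∷ r)
      s-length : length s ≡ suc m
      s-length = trans (ℕ.≡ᵇ⇒≡ _ _ (subst T (sym eq) _)) (length-norm M≉0)
      lead-s : lead s ≡ coeff m s
      lead-s = trans (lead-coeff s)
        (cong (λ n → coeff (n ∸ 1) s) (trans (cong length (norm-idem (c ∷ r))) s-length))
      lead-M : lead (norm M) ≡ coeff m M
      lead-M = trans (cong lastOr (norm-idem M)) (lead-coeff M)
      c∷A≈ : c ∷ A ≈ (0# ∷ qt ⊠ M) ⊞ (c ∷ r)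
      c∷A≈ = ∷-cong (sym (F.+-identityˡ c)) A≈
      R≈ : s ⊖ scale k (norm M) ≈ s ⊞ ⊟ (scale k M)
      R≈ = ≈-trans (norm-≈ _) (⊞-cong {s} ≈-refl (⊟-cong (scale-cong refl (norm-≈ M))))
      division-equation : c ∷ A ≈ (k ∷ qt) ⊠ M ⊞ (s ⊖ scale k (norm M))
      division-equation = begin
        c ∷ A                                                  ≈⟨ c∷A≈ ⟩
        X ⊞ (c ∷ r)                                            ≈⟨ ⊞-cong {X} ≈-refl s≈ ⟨
        X ⊞ s                                                  ≈⟨ ⊞-cong {A′ = []} (⊟-inverseʳ Y) ≈-refl ⟨
        (Y ⊞ ⊟ Y) ⊞ (X ⊞ s)                                    ≈⟨ solve 4 (λ y z x u → (y :+ z) :+ (x :+ u) := (y :+ x) :+ (u :+ z)) ≈-refl Y (⊟ Y) X s ⟩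
        (Y ⊞ X) ⊞ (s ⊞ ⊟ Y)                                    ≈⟨ ⊞-cong {Y ⊞ X} ≈-refl (≈-sym R≈) ⟩
        (k ∷ qt) ⊠ M ⊞ (s ⊖ scale k (norm M))                  ∎
        where
        open ≈-Reasoning
        X = 0# ∷ qt ⊠ M
        Y = scale k M
      coeff-R : ∀ i → coeff i (s ⊖ scale k (norm M)) ≡ coeff i s + - (k * coeff i M)
      coeff-R i = trans (at R≈ i) (trans (coeff-⊞ i s _)
        (cong (coeff i s +_) (trans (coeff-⊟ i (scale k M)) (cong -_ (coeff-scale i k M)))))
      k*lead : k * coeff m M ≡ coeff m s
      k*lead = begin
        lead s * lead (norm M) ⁻¹ * coeff m M    ≡⟨ cong₂ (λ x y → x * y ⁻¹ * coeff m M) lead-s lead-M ⟩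
        coeff m s * coeff m M ⁻¹ * coeff m M     ≡⟨ F.*-assoc _ _ _ ⟩
        coeff m s * (coeff m M ⁻¹ * coeff m M)   ≡⟨ cong (coeff m s *_) (trans (F.*-comm _ _) (inverseʳ _ (leading (degree M≉0)))) ⟩
        coeff m s * 1#                           ≡⟨ F.*-identityʳ _ ⟩
        coeff m s                                ∎
        where open ≡-Reasoning
      R<m : Below m (s ⊖ scale k (norm M))
      vanish R<m i m≤i with ℕ.m≤n⇒m<n∨m≡n m≤i
      -- The factor `k` is chosen to cancel the coefficient in degree `m`; in higher degrees both
      -- terms already vanish.
      ... | inj₂ refl = trans (coeff-R i)
        (trans (cong (λ x → coeff i s + - x) k*lead) (F.-‿inverseʳ _))
      ... | inj₁ m<i = trans (coeff-R i)
        (trans (cong₂ (λ x y → x + - (k * y))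
                  (vanish (Below-resp (≈-sym s≈) (Below-∷ c r<m)) i m<i)
                  (vanish (bounded (degree M≉0)) i m<i))
          (trans (cong (λ x → 0# + - x) (F.zeroʳ k)) (F.-‿inverseʳ 0#)))

    divModL-correct : ∀ A → Division A M (proj₁ (divModL M A)) (proj₂ (divModL M A))
    divModL-correct A rewrite divModL≡foldr M A = go A
      where
      go : ∀ B → let qt , r = foldr (divisionStep M) ([] , []) B in Division B M qt r
      go []      = ≈-refl , Below-[]
      go (c ∷ B) = divisionStep-correct c B _ _ (go B)

    division : ∀ A → Division A M (quot M A) (rem M A)
    division A with divModL M A | divModL-correct A
    ... | qt , r | p , b =
      ≈-trans p (⊞-cong (⊠-cong {B = M} (≈-sym (norm-≈ qt)) ≈-refl) (≈-sym (norm-≈ r))) ,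
      Below-resp (≈-sym (norm-≈ r)) b

    rem-unique : ∀ {A Q R} → Division A M Q R → rem M A ≈ R
    rem-unique {A} d = proj₂ (division-unique M≉0 (division A) d)

    rem-cong : ∀ {A B} → A ≈ B → rem M A ≈ rem M B
    rem-cong {A} {B} p = rem-unique {Q = quot M B} (≈-trans p (equation (division B)) , small (division B))

T-ext : ∀ {a b} → (T a → T b) → (T b → T a) → a ≡ b
T-ext {false} {false} _ _ = refl
T-ext {false} {true}  _ g = contradiction _ g
T-ext {true}  {false} f _ = contradiction _ f
T-ext {true}  {true}  _ _ = refl

-- Divisibility, Bezout identities, and correctness of the Euclidean algorithm.

module Divisibility (𝔽 : FiniteField) where
  open FiniteField 𝔽
  open Poly 𝔽
  open PolynomialRing 𝔽
  open EuclideanDivision 𝔽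
  open SemiringSolver P.commutativeSemiring using (solve; _:=_; _:+_; _:*_)

  infix 4 _∣ₚ_
  record _∣ₚ_ (M A : Pol) : Set where
    constructor cofactor
    field
      {quotient} : Pol
      factors    : quotient ⊠ M ≈ A
  open _∣ₚ_ public

  ∣-respʳ : ∀ {M A B} → A ≈ B → M ∣ₚ A → M ∣ₚ B
  ∣-respʳ p (cofactor {Q} r) = cofactor {quotient = Q} (≈-trans r p)

  ∣-respˡ : ∀ {M N A} → M ≈ N → M ∣ₚ A → N ∣ₚ A
  ∣-respˡ p (cofactor {Q} r) = cofactor {quotient = Q} (≈-trans (⊠-congʳ Q (≈-sym p)) r)

  ∣-refl : ∀ {M} → M ∣ₚ M
  ∣-refl {M} = cofactor {quotient = one} (⊠-identityˡ M)

  ∣-trans : ∀ {A B C} → A ∣ₚ B → B ∣ₚ C → A ∣ₚ C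
  ∣-trans {A} (cofactor {X} p) (cofactor {Y} r) =
    cofactor {quotient = Y ⊠ X} (≈-trans (⊠-assoc Y X A) (≈-trans (⊠-congʳ Y p) r))

  ∣-[] : ∀ {M} → M ∣ₚ []
  ∣-[] = cofactor {quotient = []} ≈-refl

  ∣-⊞ : ∀ {M A B} → M ∣ₚ A → M ∣ₚ B → M ∣ₚ A ⊞ B
  ∣-⊞ {M} (cofactor {X} p) (cofactor {Y} r) =
    cofactor {quotient = X ⊞ Y} (≈-trans (⊠-distribʳ M X Y) (⊞-cong p r))

  ∣-⊠ˡ : ∀ {M A} X → M ∣ₚ A → M ∣ₚ X ⊠ A
  ∣-⊠ˡ {M} {A} X p = ∣-trans p (cofactor {quotient = X} ≈-refl)

  ∣-⊠ʳ : ∀ {M A} X → M ∣ₚ A → M ∣ₚ A ⊠ X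
  ∣-⊠ʳ {M} {A} X p = ∣-respʳ (⊠-comm X A) (∣-⊠ˡ X p)

  ⊠-mono-∣ : ∀ {A B} X → A ∣ₚ B → A ⊠ X ∣ₚ B ⊠ X
  ⊠-mono-∣ {A} {B} X (cofactor {Q} p) =
    cofactor {quotient = Q} (≈-trans (≈-sym (⊠-assoc Q A X)) (⊠-cong {B = X} p ≈-refl))

  ⊠-cancel-∣ : ∀ {A B} X → ¬ X ≈ [] → A ⊠ X ∣ₚ B ⊠ X → A ∣ₚ B
  ⊠-cancel-∣ {A} {B} X X≉0 (cofactor {Q} p) =
    cofactor {quotient = Q} (⊠-cancelʳ X X≉0 (≈-trans (⊠-assoc Q A X) p))

  ∣⇒≉0 : ∀ {A B} → A ∣ₚ B → ¬ B ≈ [] → ¬ A ≈ []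
  ∣⇒≉0 {A} (cofactor {X} p) = factorʳ-nonzero {X} {A} p

  ∣⇒deg≤ : ∀ {A B} → A ∣ₚ B → ¬ B ≈ [] → deg A ≤ deg B
  ∣⇒deg≤ {A} {B} (cofactor {X} p) B≉0 = begin
    deg A            ≤⟨ ℕ.m≤n+m (deg A) (deg X) ⟩
    deg X ℕ.+ deg A  ≡⟨ deg-⊠ {X} {A} (factorˡ-nonzero {X} {A} p B≉0) (factorʳ-nonzero {X} {A} p B≉0) ⟨
    deg (X ⊠ A)      ≡⟨ deg-cong (X ⊠ A) B p ⟩
    deg B            ∎
    where open ℕ.≤-Reasoning

  module _ {M : Pol} (M≉0 : ¬ M ≈ []) where

    divides⇒∣ : ∀ {A} → T (divides M A) → M ∣ₚ A
    divides⇒∣ {A} t with rem M A | division M≉0 A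
    ... | [] | p , _ = cofactor {quotient = quot M A} (≈-trans (≈-sym (⊞-identityʳ _)) (≈-sym p))

    ∣⇒divides : ∀ {A} → M ∣ₚ A → T (divides M A)
    ∣⇒divides {A} (cofactor {Q} p) = subst (T ∘ null) (sym rem≡[]) _
      where
      rem≈[] : rem M A ≈ []
      rem≈[] = rem-unique M≉0 {Q = Q} (≈-trans (≈-sym p) (≈-sym (⊞-identityʳ (Q ⊠ M))) , Below-[])
      rem≡[] : rem M A ≡ []
      rem≡[] = trans (sym (norm-idem (proj₂ (divModL M A)))) (norm-zero (rem M A) rem≈[])

    quot-correct : ∀ {A} → M ∣ₚ A → quot M A ⊠ M ≈ A
    quot-correct {A} (cofactor {Q} p) = ≈-trans
      (⊠-cong {A′ = Q} {B = M} (proj₁ (division-unique M≉0 (division M≉0 A)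
        (≈-trans (≈-sym p) (≈-sym (⊞-identityʳ (Q ⊠ M))) , Below-[]))) ≈-refl) p

  divides-ext : ∀ {M A M′ A′} → ¬ M ≈ [] → ¬ M′ ≈ [] →
                (M ∣ₚ A → M′ ∣ₚ A′) → (M′ ∣ₚ A′ → M ∣ₚ A) → divides M A ≡ divides M′ A′
  divides-ext M≉0 M′≉0 f g = T-ext (∣⇒divides M′≉0 ∘ f ∘ divides⇒∣ M≉0)
                                   (∣⇒divides M≉0 ∘ g ∘ divides⇒∣ M′≉0)

  constant-⊠ : ∀ c A → [ c ] ⊠ A ≈ scale c A
  constant-⊠ c A = ≈-trans (⊞-cong {scale c A} ≈-refl (0∷[]≈[] ≈-refl)) (⊞-identityʳ (scale c A))

  degree-0 : ∀ {A} → Degree 0 A → A ≈ [ coeff 0 A ]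
  degree-0 (b , _) = ext λ { zero → refl ; (suc i) → vanish b (suc i) (s≤s z≤n) }

  degree-0-unit : ∀ {A} → Degree 0 A → A ∣ₚ one
  degree-0-unit {A} d@(b , c≢0) = cofactor {quotient = [ coeff 0 A ⁻¹ ]}
    (≈-trans (constant-⊠ _ A) (≈-trans (scale-cong refl (degree-0 d))
      (∷-cong (trans (F.*-comm _ _) (inverseʳ _ c≢0)) ≈-refl)))

  -- Coprimality as a Bezout identity: multiplicativity, cancellation and divisibility by a product
  -- then follow from ring identities alone.
  Comaximal : Pol → Pol → Set
  Comaximal A B = ∃₂ λ U V → U ⊠ A ⊞ V ⊠ B ≈ one

  comaximal-sym : ∀ {A B} → Comaximal A B → Comaximal B A
  comaximal-sym {A} {B} (U , V , p) = V , U , ≈-trans (⊞-comm (V ⊠ B) (U ⊠ A)) p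

  comaximal-oneʳ : ∀ {A} → Comaximal A one
  comaximal-oneʳ = [] , one , ⊠-identityˡ one

  -- Multiply the two Bezout identities: every term except `V V′ B C` contains the factor `A`.
  comaximal-⊠ʳ : ∀ {A B C} → Comaximal A B → Comaximal A C → Comaximal A (B ⊠ C)
  comaximal-⊠ʳ {A} {B} {C} (U , V , p) (U′ , V′ , p′) =
    U ⊠ U′ ⊠ A ⊞ U ⊠ V′ ⊠ C ⊞ V ⊠ B ⊠ U′ , V ⊠ V′ , (begin
    (U ⊠ U′ ⊠ A ⊞ U ⊠ V′ ⊠ C ⊞ V ⊠ B ⊠ U′) ⊠ A ⊞ V ⊠ V′ ⊠ (B ⊠ C)
      ≈⟨ solve 7 (λ a b c u v u′ v′ →
           (u :* u′ :* a :+ u :* v′ :* c :+ v :* b :* u′) :* a :+ v :* v′ :* (b :* c)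
           := (u :* a :+ v :* b) :* (u′ :* a :+ v′ :* c)) ≈-refl A B C U V U′ V′ ⟩
    (U ⊠ A ⊞ V ⊠ B) ⊠ (U′ ⊠ A ⊞ V′ ⊠ C)  ≈⟨ ⊠-cong p p′ ⟩
    one ⊠ one                            ≈⟨ ⊠-identityˡ one ⟩
    one                                  ∎)
    where open ≈-Reasoning

  comaximal-expand : ∀ {A B} C ((U , V , _) : Comaximal A B) → U ⊠ A ⊠ C ⊞ V ⊠ B ⊠ C ≈ C
  comaximal-expand {A} {B} C (U , V , p) =
    ≈-trans (≈-sym (⊠-distribʳ C (U ⊠ A) (V ⊠ B)))
      (≈-trans (⊠-cong {B = C} p ≈-refl) (⊠-identityˡ C))

  comaximal-cancel : ∀ {A B C} → Comaximal A B → A ∣ₚ B ⊠ C → A ∣ₚ C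
  comaximal-cancel {A} {B} {C} com@(U , V , p) d = ∣-respʳ (comaximal-expand C com)
    (∣-⊞ (∣-⊠ʳ C (∣-⊠ˡ U ∣-refl)) (∣-respʳ (≈-sym (⊠-assoc V B C)) (∣-⊠ˡ V d)))

  -- In `X = U A X + V B X`, replace `X` by a multiple of `B` in the first term and by a multiple of
  -- `A` in the second; both terms become multiples of `A B`.
  comaximal-product-∣ : ∀ {A B X} → Comaximal A B → A ∣ₚ X → B ∣ₚ X → A ⊠ B ∣ₚ X
  comaximal-product-∣ {A} {B} {X} com@(U , V , p) (cofactor {S} s) (cofactor {R} r) =
    ∣-respʳ (comaximal-expand X com) (cofactor {quotient = U ⊠ R ⊞ V ⊠ S} (begin
      (U ⊠ R ⊞ V ⊠ S) ⊠ (A ⊠ B)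
        ≈⟨ solve 6 (λ a b u v s r → (u :* r :+ v :* s) :* (a :* b)
             := u :* a :* (r :* b) :+ v :* b :* (s :* a)) ≈-refl A B U V S R ⟩
      U ⊠ A ⊠ (R ⊠ B) ⊞ V ⊠ B ⊠ (S ⊠ A)
        ≈⟨ ⊞-cong (⊠-congʳ (U ⊠ A) r) (⊠-congʳ (V ⊠ B) s) ⟩
      U ⊠ A ⊠ X ⊞ V ⊠ B ⊠ X ∎))
    where open ≈-Reasoning

  common-divisor-∣-one : ∀ {D A B} → Comaximal A B → D ∣ₚ A → D ∣ₚ B → D ∣ₚ one
  common-divisor-∣-one (U , V , p) a b = ∣-respʳ p (∣-⊞ (∣-⊠ˡ U a) (∣-⊠ˡ V b))

  deg-one : deg one ≡ 0
  deg-one = Degree⇒deg one-degree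

  ∣-one⇒deg : ∀ {A} → A ∣ₚ one → deg A ≡ 0
  ∣-one⇒deg d = ℕ.n≤0⇒n≡0 (ℕ.≤-trans (∣⇒deg≤ d one≉0) (ℕ.≤-reflexive deg-one))

  record IsGCD (a b g : Pol) : Set where
    field
      divisorˡ : g ∣ₚ a
      divisorʳ : g ∣ₚ b
      U V      : Pol
      bezout   : U ⊠ a ⊞ V ⊠ b ≈ g

  -- `coprime` looks at the raw length of the gcd, which reveals the degree only when the list has
  -- no trailing zeros.
  gcdF-normal : ∀ n a b → norm (gcdF n a b) ≡ gcdF n a b
  gcdF-normal zero    a b = norm-idem a
  gcdF-normal (suc n) a b with null (norm b)
  ... | true  = norm-idem a
  ... | false = gcdF-normal n b (rem b a)

  -- The fuel has to exceed the number of significant coefficients of `b`; a remainder modulo `b`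
  -- has strictly fewer of them, so the hypothesis survives each step.
  gcdF-correct : ∀ n a b → length (norm b) < n → IsGCD a b (gcdF n a b)
  gcdF-correct (suc n) a b b<n with null (norm b) in eq
  ... | true = record
    { divisorˡ = ∣-respˡ (≈-sym (norm-≈ a)) ∣-refl
    ; divisorʳ = ∣-respʳ (≈-sym (null-norm eq)) ∣-[]
    ; U = one ; V = []
    ; bezout = ≈-trans (⊞-identityʳ _) (≈-trans (⊠-identityˡ a) (≈-sym (norm-≈ a))) }
  ... | false = record
    { divisorˡ = ∣-respʳ (≈-sym (equation (division b≉0 a))) (∣-⊞ (∣-⊠ˡ (quot b a) divisorˡ) divisorʳ)
    ; divisorʳ = divisorˡ
    -- Obtained by substituting `rem b a = a - Q b` into the Bezout identity for `b` and `rem b a`.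
    ; U = V ; V = U ⊞ V ⊠ ⊟ Q
    ; bezout = begin
        V ⊠ a ⊞ (U ⊞ V ⊠ ⊟ Q) ⊠ b
          ≈⟨ solve 5 (λ u v a b n → v :* a :+ (u :+ v :* n) :* b := u :* b :+ v :* (n :* b :+ a)) ≈-refl U V a b (⊟ Q) ⟩
        U ⊠ b ⊞ V ⊠ (⊟ Q ⊠ b ⊞ a)
          ≈⟨ ⊞-cong {U ⊠ b} ≈-refl (⊠-congʳ V (division-difference {Q = []} {a} {Q} ≈-refl (equation (division b≉0 a)))) ⟩
        U ⊠ b ⊞ V ⊠ rem b a ≈⟨ bezout ⟩
        gcdF n b (rem b a) ∎
    }
    where
    open ≈-Reasoning
    b≉0 : ¬ b ≈ []
    b≉0 p = contradiction (trans (sym eq) (cong null (norm-zero b p))) λ ()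
    Q : Pol
    Q = quot b a
    open IsGCD (gcdF-correct n b (rem b a)
      (ℕ.≤-trans (s≤s (Below⇒length (small (division b≉0 a))))
        (ℕ.≤-trans (ℕ.≤-reflexive (sym (length-norm b≉0))) (ℕ.≤-pred b<n))))

  length-norm-≤ : ∀ A → length (norm A) ≤ length A
  length-norm-≤ A = Below⇒length (Below-length A)

  gcd-correct : ∀ a b → IsGCD a b (gcdP a b)
  gcd-correct a b = gcdF-correct (suc (length a ℕ.+ length b)) a b
    (s≤s (ℕ.≤-trans (length-norm-≤ b) (ℕ.m≤n+m (length b) (length a))))

  gcd-degree-0⇒comaximal : ∀ {a b} → ¬ gcdP a b ≈ [] → deg (gcdP a b) ≡ 0 → Comaximal a b
  gcd-degree-0⇒comaximal {a} {b} g≉0 deg≡0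
    with cofactor {W} p ← degree-0-unit (subst (λ n → Degree n (gcdP a b)) deg≡0 (degree g≉0)) =
    W ⊠ U , W ⊠ V , (begin
      W ⊠ U ⊠ a ⊞ W ⊠ V ⊠ b
        ≈⟨ solve 5 (λ w u v a b → w :* u :* a :+ w :* v :* b := w :* (u :* a :+ v :* b)) ≈-refl W U V a b ⟩
      W ⊠ (U ⊠ a ⊞ V ⊠ b) ≈⟨ ⊠-congʳ W bezout ⟩
      W ⊠ gcdP a b        ≈⟨ p ⟩
      one                 ∎)
    where
    open ≈-Reasoning
    open IsGCD (gcd-correct a b)

  module _ {a b : Pol} (b≉0 : ¬ b ≈ []) where
    private
      g = gcdP a b
      g≉0 : ¬ g ≈ []
      g≉0 = ∣⇒≉0 (IsGCD.divisorʳ (gcd-correct a b)) b≉0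
      length-g : length g ≡ suc (deg g)
      length-g = trans (cong length (sym (gcdF-normal (suc (length a ℕ.+ length b)) a b))) (length-norm g≉0)

    coprime⇒comaximal : T (coprime a b) → Comaximal a b
    coprime⇒comaximal t = gcd-degree-0⇒comaximal g≉0
      (ℕ.suc-injective (trans (sym length-g) (ℕ.≡ᵇ⇒≡ _ _ t)))

    comaximal⇒coprime : Comaximal a b → T (coprime a b)
    comaximal⇒coprime com = ℕ.≡⇒≡ᵇ (length g) 1 (trans length-g (cong suc (∣-one⇒deg
      (common-divisor-∣-one com (IsGCD.divisorˡ (gcd-correct a b)) (IsGCD.divisorʳ (gcd-correct a b))))))

-- Enumeration of polynomials and monic irreducibles.

module Irreducibles (𝔽 : FiniteField) where
  open FiniteField 𝔽
  open Poly 𝔽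
  open PolynomialRing 𝔽
  open EuclideanDivision 𝔽
  open Divisibility 𝔽

  record Monic (d : ℕ) (P : Pol) : Set where
    constructor _,_
    field
      length≡   : length P ≡ suc d
      leading≡1 : coeff d P ≡ 1#
  open Monic public

  Monic⇒Degree : ∀ {d P} → Monic d P → Degree d P
  Monic⇒Degree {P = P} (l , c) =
    subst (λ n → Below n P) l (Below-length P) , λ e → 0≢1 (trans (sym e) c)

  Monic⇒deg : ∀ {d P} → Monic d P → deg P ≡ d
  Monic⇒deg m = Degree⇒deg (Monic⇒Degree m)

  Monic⇒≉0 : ∀ {d P} → Monic d P → ¬ P ≈ []
  Monic⇒≉0 m = Degree⇒≉0 (Monic⇒Degree m)

  ≈∧length⇒≡ : ∀ A B → length A ≡ length B → A ≈ B → A ≡ B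
  ≈∧length⇒≡ []      []      _ _ = refl
  ≈∧length⇒≡ (a ∷ A) (b ∷ B) l p =
    cong₂ _∷_ (at p 0) (≈∧length⇒≡ A B (ℕ.suc-injective l) (proj₂ (∷-injective p)))

  allOfLength⁺ : ∀ v → v ∈ allOfLength (length v)
  allOfLength⁺ []      = here refl
  allOfLength⁺ (c ∷ v) = ∈-concatMap⁺ _ (lose (complete c) (∈-map⁺ (c ∷_) (allOfLength⁺ v)))

  allOfLength⁻ : ∀ d {v} → v ∈ allOfLength d → length v ≡ d
  allOfLength⁻ zero    (here refl) = refl
  allOfLength⁻ (suc d) v∈ with find (∈-concatMap⁻ (λ c → map (c ∷_) (allOfLength d)) {elements} v∈)
  ... | c , _ , v∈map with ∈-map⁻ (c ∷_) v∈map
  ...   | w , w∈ , refl = cong suc (allOfLength⁻ d w∈)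

  allOfLength-unique : ∀ d → Unique (allOfLength d)
  allOfLength-unique zero    = [] ∷ []
  allOfLength-unique (suc d) = Unique.concat⁺
    (All.map⁺ (All.universal (λ c → Unique.map⁺ ∷-injectiveʳ (allOfLength-unique d)) elements))
    (AllPairs.map⁺ (AllPairs.map disjoint unique))
    where
    disjoint : ∀ {c c′} → c ≢ c′ →
      Disjoint (map (c ∷_) (allOfLength d)) (map (c′ ∷_) (allOfLength d))
    disjoint {c} {c′} c≢c′ (p , p′) with ∈-map⁻ (c ∷_) p | ∈-map⁻ (c′ ∷_) p′
    ... | _ , _ , refl | _ , _ , e = c≢c′ (∷-injectiveˡ e)

  Monic-snoc : ∀ v → Monic (length v) (v ++ [ 1# ])
  Monic-snoc []      = refl , refl
  Monic-snoc (x ∷ v) with l , c ← Monic-snoc v = cong suc l , c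

  monicOfDeg⁻ : ∀ {d P} → P ∈ monicOfDeg d → Monic d P
  monicOfDeg⁻ {d} P∈ with ∈-map⁻ (_++ [ 1# ]) P∈
  ... | v , v∈ , refl = subst (λ n → Monic n (v ++ [ 1# ])) (allOfLength⁻ d v∈) (Monic-snoc v)

  Monic-unsnoc : ∀ {d P} → Monic d P → ∃ λ v → length v ≡ d × P ≡ v ++ [ 1# ]
  Monic-unsnoc {zero}  {x ∷ []}    (_ , c) = [] , refl , cong [_] c
  Monic-unsnoc {suc d} {x ∷ y ∷ P} (l , c) with Monic-unsnoc {d} {y ∷ P} (ℕ.suc-injective l , c)
  ... | v , lv , e = x ∷ v , cong suc lv , cong (x ∷_) e

  monicOfDeg⁺ : ∀ {d P} → Monic d P → P ∈ monicOfDeg d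
  monicOfDeg⁺ m with Monic-unsnoc m
  ... | v , refl , refl = ∈-map⁺ (_++ [ 1# ]) (allOfLength⁺ v)

  monicOfDeg1to⁺ : ∀ {n d P} → 0 < d → d ≤ n → Monic d P → P ∈ monicOfDeg1to n
  monicOfDeg1to⁺ {d = suc d} _ d<n m =
    ∈-concatMap⁺ monicOfDeg (lose (∈-applyUpTo⁺ suc d<n) (monicOfDeg⁺ m))

  monicOfDeg1to⁻ : ∀ {n P} → P ∈ monicOfDeg1to n → ∃ λ d → 0 < d × d ≤ n × Monic d P
  monicOfDeg1to⁻ {n} P∈ with find (∈-concatMap⁻ monicOfDeg {applyUpTo suc n} P∈)
  ... | d , d∈ , P∈d with ∈-applyUpTo⁻ suc d∈
  ...   | i , i<n , refl = suc i , s≤s z≤n , i<n , monicOfDeg⁻ P∈d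

  monicOfDeg1to-unique : ∀ n → Unique (monicOfDeg1to n)
  monicOfDeg1to-unique n = Unique.concat⁺
    (All.map⁺ (All.universal (λ d → Unique.map⁺ (λ {v} {w} → ++-cancelʳ [ 1# ] v w) (allOfLength-unique d)) _))
    (AllPairs.map⁺ (AllPairs.applyUpTo⁺₁ suc n λ i<j _ (p , p′) →
      ℕ.<⇒≢ (s≤s i<j) (trans (sym (Monic⇒deg (monicOfDeg⁻ p))) (Monic⇒deg (monicOfDeg⁻ p′)))))

  record MonicAssociate (A : Pol) : Set where
    field
      {associate} : Pol
      monic    : Monic (deg A) associate
      divisor  : associate ∣ₚ A

  monicAssociate : ∀ {A} → ¬ A ≈ [] → MonicAssociate A
  monicAssociate {A} A≉0 = record
    { associate = scale (c ⁻¹) (norm A)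
    ; monic = trans (length-map (c ⁻¹ *_) (norm A)) (length-norm A≉0) ,
        (begin
          coeff (deg A) (scale (c ⁻¹) (norm A)) ≡⟨ coeff-scale (deg A) (c ⁻¹) (norm A) ⟩
          c ⁻¹ * coeff (deg A) (norm A)         ≡⟨ cong (c ⁻¹ *_) (at (norm-≈ A) (deg A)) ⟩
          c ⁻¹ * c                              ≡⟨ F.*-comm _ _ ⟩
          c * c ⁻¹                              ≡⟨ inverse ⟩
          1#                                    ∎)
    ; divisor = cofactor {quotient = [ c ]}
        (≈-trans (constant-⊠ c _) (≈-trans (scale-scale c (c ⁻¹) (norm A))
          (≈-trans (scale-cong inverse (norm-≈ A)) (scale-1 A))))
    }
    where
    open ≡-Reasoning
    c : Carrier
    c = coeff (deg A) A
    inverse : c * c ⁻¹ ≡ 1#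
    inverse = inverseʳ c (leading (degree A≉0))

  -- Propositional counterpart of `irreducible`: it rules out just the divisors the Boolean test
  -- tries, monic and of degree strictly between 0 and that of `P`. For other divisors one passes to
  -- the monic associate.
  record MonicIrreducible (P : Pol) : Set where
    field
      degP     : ℕ
      monic    : Monic degP P
      positive : 0 < degP
      minimal  : ∀ {d Q} → 0 < d → d < degP → Monic d Q → ¬ Q ∣ₚ P

    nonzero : ¬ P ≈ []
    nonzero = Monic⇒≉0 monic

    not-∣-one : ¬ P ∣ₚ one
    not-∣-one d = ℕ.<⇒≢ positive (sym (trans (sym (Monic⇒deg monic)) (∣-one⇒deg d)))

  irreducible⁻ : ∀ {d P} → Monic d P → T (irreducible P) → MonicIrreducible P
  irreducible⁻ {d} {P} m t = record
    { degP = d ; monic = m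
    ; positive = subst (0 <_) degP≡d (ℕ.<ᵇ⇒< 0 _ (proj₁ t∧))
    ; minimal = λ {e} {Q} 0<e e<d mQ Q∣P →
        contradiction (∣⇒divides (Monic⇒≉0 mQ) Q∣P)
          (¬T (All.lookup (All.all⁺ (λ Q → not (divides Q P)) _ (proj₂ t∧))
            (monicOfDeg1to⁺ 0<e (ℕ.≤-pred (subst (suc e ≤_) (sym (suc-pred-deg 0<e e<d)) e<d)) mQ)))
    }
    where
    degP≡d : deg P ≡ d
    degP≡d = Monic⇒deg m
    t∧ = Equivalence.to T-∧ t
    ¬T : ∀ {b} → T (not b) → ¬ T b
    ¬T {false} _ ()
    suc-pred-deg : ∀ {e} → 0 < e → e < d → suc (deg P ∸ 1) ≡ d
    suc-pred-deg 0<e e<d rewrite degP≡d = ℕ.m+[n∸m]≡n (ℕ.≤-trans 0<e (ℕ.<⇒≤ e<d))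

  -- The test is a finite search, so its failure produces an actual divisor and not merely a double
  -- negation.
  reducible : ∀ {d P} → Monic d P → 0 < d → ¬ T (irreducible P) →
              ∃₂ λ e Q → 0 < e × e < d × Monic e Q × Q ∣ₚ P
  reducible {suc d} {P} m 0<d ¬irr
    with Any¬ ← All.¬All⇒Any¬ (λ Q → T? (not (divides Q P))) (monicOfDeg1to (deg P ∸ 1))
           (λ all → ¬irr (Equivalence.from T-∧
             (ℕ.<⇒<ᵇ (subst (0 <_) (sym (Monic⇒deg m)) 0<d) , All.all⁻ (λ Q → not (divides Q P)) all)))
    with Q , Q∈ , ¬t ← find Any¬
    with e , 0<e , e≤ , mQ ← monicOfDeg1to⁻ Q∈ =
    e , Q , 0<e , s≤s (subst (λ n → e ≤ n ∸ 1) (Monic⇒deg m) e≤) , mQ ,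
    divides⇒∣ (Monic⇒≉0 mQ) (¬not ¬t)
    where
    ¬not : ∀ {b} → ¬ T (not b) → T b
    ¬not {true}  _ = _
    ¬not {false} f = contradiction _ f

  -- Used to extract a prime from a nonconstant gcd. The descent is bounded by `n`: a monic
  -- associate that is not irreducible has a monic divisor of smaller positive degree.
  irreducibleFactor : ∀ n A → ¬ A ≈ [] → 0 < deg A → deg A ≤ n →
    ∃₂ λ d P → Monic d P × T (irreducible P) × P ∣ₚ A
  irreducibleFactor zero    A A≉0 0<d d≤n = contradiction (ℕ.≤-trans 0<d d≤n) λ ()
  irreducibleFactor (suc n) A A≉0 0<d d≤n with monicAssociate A≉0
  ... | record { associate = A₀ ; monic = m ; divisor = A₀∣A } with T? (irreducible A₀)
  ...   | yes irr = deg A , A₀ , m , irr , A₀∣A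
  ...   | no ¬irr with reducible m 0<d ¬irr
  ...     | e , Q , 0<e , e<d , mQ , Q∣A₀
      with irreducibleFactor n Q (Monic⇒≉0 mQ) (subst (0 <_) (sym (Monic⇒deg mQ)) 0<e)
             (subst (_≤ n) (sym (Monic⇒deg mQ)) (ℕ.≤-pred (ℕ.≤-trans e<d d≤n)))
  ...       | d , P , mP , irr , P∣Q = d , P , mP , irr , ∣-trans P∣Q (∣-trans Q∣A₀ A₀∣A)

  divisor-of-equal-degree : ∀ {A B} → ¬ B ≈ [] → A ∣ₚ B → deg A ≡ deg B → ∃ λ c → scale c A ≈ B
  divisor-of-equal-degree {A} {B} B≉0 (cofactor {X} p) degA≡degB =
    coeff 0 X , ≈-trans (≈-sym (constant-⊠ _ A)) (≈-trans (⊠-cong {B = A} (≈-sym (degree-0 X-degree)) ≈-refl) p)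
    where
    X≉0 : ¬ X ≈ []
    X≉0 = factorˡ-nonzero {X} {A} p B≉0
    degX≡0 : deg X ≡ 0
    degX≡0 = ℕ.+-cancelʳ-≡ (deg A) (deg X) 0 (begin
      deg X ℕ.+ deg A ≡⟨ deg-⊠ {X} {A} X≉0 (factorʳ-nonzero {X} {A} p B≉0) ⟨
      deg (X ⊠ A)     ≡⟨ deg-cong (X ⊠ A) B p ⟩
      deg B           ≡⟨ degA≡degB ⟨
      deg A           ∎)
      where open ≡-Reasoning
    X-degree : Degree 0 X
    X-degree = subst (λ n → Degree n X) degX≡0 (degree X≉0)

  module _ {P : Pol} (irr : MonicIrreducible P) where
    open MonicIrreducible irr

    divisor-degree : ∀ {A} → A ∣ₚ P → deg A ≡ 0 ⊎ deg A ≡ deg P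
    divisor-degree {A} A∣P with deg A ℕ.≟ 0 | ℕ.m≤n⇒m<n∨m≡n (∣⇒deg≤ A∣P nonzero)
    ... | yes e | _        = inj₁ e
    ... | no  _ | inj₂ e   = inj₂ e
    ... | no ≢0 | inj₁ A<P = contradiction
      (∣-trans (MonicAssociate.divisor A₀) A∣P)
      (minimal (ℕ.n≢0⇒n>0 ≢0) (subst (deg A <_) (Monic⇒deg monic) A<P) (MonicAssociate.monic A₀))
      where A₀ = monicAssociate (∣⇒≉0 A∣P nonzero)

    -- The gcd of `P` and `A` divides `P`, so it is either a nonzero constant, hence a unit, or a
    -- scalar multiple of `P`.
    ∣⊎comaximal : ∀ A → P ∣ₚ A ⊎ Comaximal P A
    ∣⊎comaximal A with gcd-correct P A
    ... | record { divisorˡ = g∣P ; divisorʳ = g∣A } with divisor-degree g∣P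
    ...   | inj₁ e = inj₂ (gcd-degree-0⇒comaximal (∣⇒≉0 g∣P nonzero) e)
    ...   | inj₂ e with divisor-of-equal-degree nonzero g∣P e
    ...     | c , cg≈P = inj₁ (∣-trans (cofactor {quotient = [ c ⁻¹ ]} (begin
      [ c ⁻¹ ] ⊠ P               ≈⟨ constant-⊠ (c ⁻¹) P ⟩
      scale (c ⁻¹) P             ≈⟨ scale-cong refl (≈-sym cg≈P) ⟩
      scale (c ⁻¹) (scale c g)   ≈⟨ scale-scale (c ⁻¹) c g ⟩
      scale (c ⁻¹ * c) g         ≈⟨ scale-cong (trans (F.*-comm _ _) (inverseʳ c c≢0)) ≈-refl ⟩
      scale 1# g                 ≈⟨ scale-1 g ⟩
      g                          ∎)) g∣A)
      where
      open ≈-Reasoning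
      g : Pol
      g = gcdP P A
      c≢0 : c ≢ 0#
      c≢0 c≡0 = nonzero (≈-trans (≈-sym cg≈P) (≈-trans (scale-cong c≡0 ≈-refl) (scale-0 g)))

    comaximal⇒∤ : ∀ {A} → Comaximal P A → ¬ P ∣ₚ A
    comaximal⇒∤ com P∣A = not-∣-one (common-divisor-∣-one com ∣-refl P∣A)

  -- By degrees `P` and `Q` differ by a scalar, and comparing leading coefficients makes it 1.
  -- Equality of lists is reached because `Monic` fixes the length.
  irreducible-∣⇒≡ : ∀ {P Q} → MonicIrreducible P → MonicIrreducible Q → P ∣ₚ Q → P ≡ Q
  irreducible-∣⇒≡ {P} {Q} irrP irrQ P∣Q with divisor-degree irrQ P∣Q
  ... | inj₁ e = contradiction (trans (sym (Monic⇒deg 𝐏.monic)) e) (ℕ.>⇒≢ 𝐏.positive)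
    where module 𝐏 = MonicIrreducible irrP
  ... | inj₂ e with divisor-of-equal-degree (MonicIrreducible.nonzero irrQ) P∣Q e
  ...   | c , cP≈Q = ≈∧length⇒≡ P Q
      (trans (length≡ 𝐏.monic) (trans (cong suc d≡) (sym (length≡ 𝐐.monic))))
      (≈-trans (≈-sym (scale-1 P)) (≈-trans (scale-cong (sym c≡1) ≈-refl) cP≈Q))
    where
    module 𝐏 = MonicIrreducible irrP
    module 𝐐 = MonicIrreducible irrQ
    d≡ : 𝐏.degP ≡ 𝐐.degP
    d≡ = trans (sym (Monic⇒deg 𝐏.monic)) (trans e (Monic⇒deg 𝐐.monic))
    open ≡-Reasoning
    c≡1 : c ≡ 1#
    c≡1 = begin
      c                       ≡⟨ F.*-identityʳ c ⟨
      c * 1#                  ≡⟨ cong (c *_) (leading≡1 𝐏.monic) ⟨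
      c * coeff 𝐏.degP P      ≡⟨ coeff-scale 𝐏.degP c P ⟨
      coeff 𝐏.degP (scale c P) ≡⟨ at cP≈Q 𝐏.degP ⟩
      coeff 𝐏.degP Q          ≡⟨ cong (λ n → coeff n Q) d≡ ⟩
      coeff 𝐐.degP Q          ≡⟨ leading≡1 𝐐.monic ⟩
      1#                      ∎

  distinct⇒comaximal : ∀ {P Q} → MonicIrreducible P → MonicIrreducible Q → P ≢ Q → Comaximal P Q
  distinct⇒comaximal {P} {Q} irrP irrQ P≢Q with ∣⊎comaximal irrP Q
  ... | inj₁ P∣Q = contradiction (irreducible-∣⇒≡ irrP irrQ P∣Q) P≢Q
  ... | inj₂ com = com

  -- `monicIrrDivisors A` is the case `n = deg A`. A free cut-off makes the prime divisors of
  -- different polynomials filters of one and the same list.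
  irreducibleDivisors : ℕ → Pol → List Pol
  irreducibleDivisors n A = filterᵇ (λ P → irreducible P ∧ divides P A) (monicOfDeg1to n)

  irreducibleDivisors⁻ : ∀ {n A P} → P ∈ irreducibleDivisors n A → MonicIrreducible P × P ∣ₚ A
  irreducibleDivisors⁻ {n} {A} P∈
    with P∈monic , t ← ∈-filter⁻ (λ P → T? (irreducible P ∧ divides P A)) {xs = monicOfDeg1to n} P∈
    with _ , _ , _ , m ← monicOfDeg1to⁻ {n} P∈monic
    with irr , P∣A ← Equivalence.to T-∧ t =
    irreducible⁻ m irr , divides⇒∣ (Monic⇒≉0 m) P∣A

  irreducibleDivisors⁺ : ∀ {n A P} → P ∈ monicOfDeg1to n → T (irreducible P) → P ∣ₚ A →
                         P ∈ irreducibleDivisors n A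
  irreducibleDivisors⁺ {n} {A} P∈ irr P∣A
    with _ , _ , _ , m ← monicOfDeg1to⁻ {n} P∈ =
    ∈-filter⁺ (λ P → T? (irreducible P ∧ divides P A)) P∈
      (Equivalence.from T-∧ (irr , ∣⇒divides (Monic⇒≉0 m) P∣A))

  irreducibleDivisors-comaximal : ∀ n A → AllPairs Comaximal (irreducibleDivisors n A)
  irreducibleDivisors-comaximal n A = pairs
    (All.tabulate (λ P∈ → proj₁ (irreducibleDivisors⁻ {n} {A} P∈)))
    (Unique.filter⁺ (λ P → T? (irreducible P ∧ divides P A)) (monicOfDeg1to-unique n))
    where
    pairs : ∀ {Ps} → All MonicIrreducible Ps → Unique Ps → AllPairs Comaximal Ps
    pairs []           []           = []
    pairs (irr ∷ irrs) (P∉ ∷ uniq) =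
      All.zipWith (λ (irr′ , P≢Q) → distinct⇒comaximal irr irr′ P≢Q) (irrs , P∉) ∷ pairs irrs uniq

-- The radical, its Möbius value, and coprimality tested on primes.

module Radical (𝔽 : FiniteField) where
  open FiniteField 𝔽
  open Poly 𝔽
  open PolynomialRing 𝔽
  open EuclideanDivision 𝔽
  open Divisibility 𝔽
  open Irreducibles 𝔽

  prod-∷ : ∀ P Ps → prod (P ∷ Ps) ≈ P ⊠ prod Ps
  prod-∷ P Ps = norm-≈ (P ⊠ prod Ps)

  comaximal-respʳ : ∀ {A B C} → B ≈ C → Comaximal A B → Comaximal A C
  comaximal-respʳ {A} {B} {C} p (U , V , r) =
    U , V , ≈-trans (⊞-cong {U ⊠ A} ≈-refl (⊠-congʳ V (≈-sym p))) r

  comaximal-prod : ∀ {A Ps} → All (Comaximal A) Ps → Comaximal A (prod Ps)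
  comaximal-prod []                  = comaximal-oneʳ
  comaximal-prod {Ps = P ∷ Ps} (c ∷ cs) =
    comaximal-respʳ (≈-sym (prod-∷ P Ps)) (comaximal-⊠ʳ c (comaximal-prod cs))

  prod-∣ : ∀ {X Ps} → AllPairs Comaximal Ps → All (_∣ₚ X) Ps → prod Ps ∣ₚ X
  prod-∣ {X} [] [] = cofactor {quotient = X} (⊠-identityʳ X)
  prod-∣ {Ps = P ∷ Ps} (c ∷ cs) (d ∷ ds) =
    ∣-respˡ (≈-sym (prod-∷ P Ps)) (comaximal-product-∣ (comaximal-prod c) d (prod-∣ cs ds))

  ∈⇒∣prod : ∀ {P Ps} → P ∈ Ps → P ∣ₚ prod Ps
  ∈⇒∣prod {P} {_ ∷ Ps} (here refl) =
    ∣-respʳ (≈-sym (prod-∷ P Ps)) (∣-⊠ʳ (prod Ps) ∣-refl)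
  ∈⇒∣prod {P} {Q ∷ Ps} (there P∈) =
    ∣-respʳ (≈-sym (prod-∷ Q Ps)) (∣-⊠ˡ Q (∈⇒∣prod P∈))

  prod-squarefree : ∀ {P Ps} → All MonicIrreducible Ps → AllPairs Comaximal Ps → P ∈ Ps →
                    ¬ P ⊠ P ∣ₚ prod Ps
  prod-squarefree {P} {_ ∷ Ps} (irr ∷ irrs) (c ∷ cs) (here refl) d =
    comaximal⇒∤ irr (comaximal-prod c)
      (⊠-cancel-∣ P (MonicIrreducible.nonzero irr)
        (∣-respʳ (≈-trans (prod-∷ P Ps) (⊠-comm P (prod Ps))) d))
  prod-squarefree {P} {Q ∷ Ps} (irr ∷ irrs) (c ∷ cs) (there P∈) d =
    prod-squarefree irrs cs P∈
      (comaximal-cancel (comaximal-sym (comaximal-⊠ʳ Q⊥P Q⊥P)) (∣-respʳ (prod-∷ Q Ps) d))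
    where
    Q⊥P : Comaximal Q P
    Q⊥P = All.lookup c P∈

  monicOfDeg1to-suc : ∀ n → monicOfDeg1to (suc n) ≡ monicOfDeg1to n ++ monicOfDeg (suc n)
  monicOfDeg1to-suc n = begin
    concatMap monicOfDeg (applyUpTo suc (suc n))
      ≡⟨ cong (concatMap monicOfDeg) (applyUpTo-∷ʳ suc n) ⟨
    concatMap monicOfDeg (applyUpTo suc n ++ [ suc n ])
      ≡⟨ concatMap-++ monicOfDeg (applyUpTo suc n) [ suc n ] ⟩
    monicOfDeg1to n ++ (monicOfDeg (suc n) ++ [])
      ≡⟨ cong (monicOfDeg1to n ++_) (++-identityʳ _) ⟩
    monicOfDeg1to n ++ monicOfDeg (suc n) ∎
    where open ≡-Reasoning

  module _ {A : Pol} (A≉0 : ¬ A ≈ []) where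
    private
      divisor? = λ P → T? (irreducible P ∧ divides P A)

    irreducibleDivisors-suc : ∀ n → deg A ≤ n → irreducibleDivisors (suc n) A ≡ irreducibleDivisors n A
    irreducibleDivisors-suc n degA≤n = begin
      irreducibleDivisors (suc n) A
        ≡⟨ cong (filterᵇ _) (monicOfDeg1to-suc n) ⟩
      filterᵇ _ (monicOfDeg1to n ++ monicOfDeg (suc n))
        ≡⟨ filter-++ divisor? (monicOfDeg1to n) (monicOfDeg (suc n)) ⟩
      irreducibleDivisors n A ++ filterᵇ _ (monicOfDeg (suc n))
        ≡⟨ cong (irreducibleDivisors n A ++_) (filter-none divisor? (All.tabulate too-large)) ⟩
      irreducibleDivisors n A ++ []
        ≡⟨ ++-identityʳ _ ⟩
      irreducibleDivisors n A ∎
      where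
      open ≡-Reasoning
      too-large : ∀ {P} → P ∈ monicOfDeg (suc n) → ¬ T (irreducible P ∧ divides P A)
      too-large {P} P∈ t with m ← monicOfDeg⁻ {suc n} P∈ = ℕ.<⇒≱ (s≤s degA≤n)
        (subst (_≤ deg A) (Monic⇒deg m)
          (∣⇒deg≤ (divides⇒∣ (Monic⇒≉0 m) (proj₂ (Equivalence.to (T-∧ {irreducible P}) t))) A≉0))

    -- A divisor of `A` has degree at most `deg A`, so raising the cut-off beyond that adds no
    -- entries.
    irreducibleDivisors-stable : ∀ {n} → deg A ≤ n → irreducibleDivisors n A ≡ monicIrrDivisors A
    irreducibleDivisors-stable degA≤n = go (ℕ.≤⇒≤′ degA≤n)
      where
      go : ∀ {n} → deg A ℕ.≤′ n → irreducibleDivisors n A ≡ monicIrrDivisors A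
      go (ℕ.≤′-reflexive refl) = refl
      go (ℕ.≤′-step {n} le) = trans (irreducibleDivisors-suc n (ℕ.≤′⇒≤ le)) (go le)

  monicIrrDivisors-irreducible : ∀ A → All MonicIrreducible (monicIrrDivisors A)
  monicIrrDivisors-irreducible A = All.tabulate λ P∈ → proj₁ (irreducibleDivisors⁻ {deg A} {A} P∈)

  monicIrrDivisors-∣ : ∀ A → All (_∣ₚ A) (monicIrrDivisors A)
  monicIrrDivisors-∣ A = All.tabulate λ P∈ → proj₂ (irreducibleDivisors⁻ {deg A} {A} P∈)

  ¬T⇒false : ∀ {b} → ¬ T b → b ≡ false
  ¬T⇒false {false} _ = refl
  ¬T⇒false {true}  f = contradiction _ f

  if-false : ∀ {X : Set} {b} {x y : X} → b ≡ false → (if b then x else y) ≡ y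
  if-false refl = refl

  μ-squarefree : ∀ {A} → ¬ A ≈ [] → (∀ {P} → P ∈ monicIrrDivisors A → ¬ P ⊠ P ∣ₚ A) →
                 μ A ≡ (ℤ.- ℤ.1ℤ) ℤ.^ length (monicIrrDivisors A)
  μ-squarefree {A} A≉0 squarefree = trans
    (if-false {b = null (norm A)} (¬T⇒false λ t → A≉0 (null-norm (Equivalence.to T-≡ t))))
    (if-false {b = any (λ P → divides (P ⊗ P) A) (monicIrrDivisors A)} (¬T⇒false no-square))
    where
    no-square : ¬ T (any (λ P → divides (P ⊗ P) A) (monicIrrDivisors A))
    no-square t with P , P∈ , d ← find (Any.any⁻ (λ P → divides (P ⊗ P) A) (monicIrrDivisors A) t) =
      squarefree P∈ (∣-respˡ (norm-≈ (P ⊠ P)) (divides⇒∣ P⊗P≉0 d))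
      where
      P≉0 : ¬ P ≈ []
      P≉0 = MonicIrreducible.nonzero (proj₁ (irreducibleDivisors⁻ {deg A} {A} P∈))
      P⊗P≉0 : ¬ P ⊗ P ≈ []
      P⊗P≉0 z = ⊠-nonzero P≉0 P≉0 (≈-trans (≈-sym (norm-≈ (P ⊠ P))) z)

  module _ {A : Pol} (A≉0 : ¬ A ≈ []) where

    rad-∣ : rad A ∣ₚ A
    rad-∣ = prod-∣ (irreducibleDivisors-comaximal (deg A) A) (monicIrrDivisors-∣ A)

    rad-nonzero : ¬ rad A ≈ []
    rad-nonzero = ∣⇒≉0 rad-∣ A≉0

    star⊠rad : star A ⊠ rad A ≈ A
    star⊠rad = quot-correct rad-nonzero rad-∣

    -- With the cut-off `deg A` for both, the two filters agree entrywise: `rad A` divides `A`, and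
    -- each listed prime divisor of `A` is a factor of `rad A`.
    monicIrrDivisors-rad : monicIrrDivisors (rad A) ≡ monicIrrDivisors A
    monicIrrDivisors-rad = trans
      (sym (irreducibleDivisors-stable rad-nonzero (∣⇒deg≤ rad-∣ A≉0)))
      (filterᵇ-cong (monicOfDeg1to (deg A)) λ {P} P∈ → T-ext
        (λ t → let irr , d = Equivalence.to (T-∧ {irreducible P}) t
                   P≉0 = Monic⇒≉0 (proj₂ (proj₂ (proj₂ (monicOfDeg1to⁻ {deg A} P∈))))
               in Equivalence.from T-∧ (irr , ∣⇒divides P≉0 (∣-trans (divides⇒∣ P≉0 d) rad-∣)))
        (λ t → let irr , d = Equivalence.to (T-∧ {irreducible P}) t
                   P≉0 = Monic⇒≉0 (proj₂ (proj₂ (proj₂ (monicOfDeg1to⁻ {deg A} P∈))))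
               in Equivalence.from T-∧ (irr ,
                    ∣⇒divides P≉0 (∈⇒∣prod (irreducibleDivisors⁺ {deg A} {A} P∈ irr (divides⇒∣ P≉0 d))))))
      where
      filterᵇ-cong : ∀ {p r : Pol → Bool} xs → (∀ {x} → x ∈ xs → p x ≡ r x) → filterᵇ p xs ≡ filterᵇ r xs
      filterᵇ-cong []       eq = refl
      filterᵇ-cong {p} {r} (x ∷ xs) eq with p x | r x | eq (here refl)
      ... | true  | _ | refl = cong (x ∷_) (filterᵇ-cong xs (eq ∘ there))
      ... | false | _ | refl = filterᵇ-cong xs (eq ∘ there)

    μ-rad : μ (rad A) ≡ (ℤ.- ℤ.1ℤ) ℤ.^ length (monicIrrDivisors A)
    μ-rad = trans
      (μ-squarefree rad-nonzero λ P∈ →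
        prod-squarefree (monicIrrDivisors-irreducible A) (irreducibleDivisors-comaximal (deg A) A)
          (subst (_ ∈_) monicIrrDivisors-rad P∈))
      (cong (λ Ps → (ℤ.- ℤ.1ℤ) ℤ.^ length Ps) monicIrrDivisors-rad)

    -- A common prime would divide 1 by the Bezout identity. Conversely, a nonconstant gcd has a
    -- monic irreducible factor, which appears in the list because it divides `A`.
    coprime⇔no-common-irreducible : ∀ D →
      coprime D A ≡ all (λ P → not (divides P D)) (monicIrrDivisors A)
    coprime⇔no-common-irreducible D = T-ext
      (λ t → All.all⁻ _ (All.tabulate λ {P} P∈ → let irr = All.lookup (monicIrrDivisors-irreducible A) P∈ in
        Equivalence.from T-not-≡ (¬T⇒false λ P∣D → MonicIrreducible.not-∣-one irr
          (common-divisor-∣-one (coprime⇒comaximal {D} A≉0 t)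
            (divides⇒∣ (MonicIrreducible.nonzero irr) P∣D) (All.lookup (monicIrrDivisors-∣ A) P∈)))))
      (λ t → comaximal⇒coprime {D} A≉0 (gcd-degree-0⇒comaximal {D} g≉0 (degree≡0 (All.all⁺ _ _ t))))
      where
      open IsGCD (gcd-correct D A)
      g = gcdP D A
      g≉0 : ¬ g ≈ []
      g≉0 = ∣⇒≉0 divisorʳ A≉0
      degree≡0 : All (λ P → T (not (divides P D))) (monicIrrDivisors A) → deg g ≡ 0
      degree≡0 none with deg g ℕ.≟ 0
      ... | yes e = e
      ... | no ≢0 with irreducibleFactor (deg g) g g≉0 (ℕ.n≢0⇒n>0 ≢0) ℕ.≤-refl
      ...   | d , P , m , irr , P∣g = contradiction
        (Equivalence.to T-≡ (∣⇒divides (Monic⇒≉0 m) (∣-trans P∣g divisorˡ)))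
        λ e → contradiction (trans (sym e) (Equivalence.to T-not-≡ (All.lookup none P∈))) λ ()
        where
        P∣A : P ∣ₚ A
        P∣A = ∣-trans P∣g divisorʳ
        P∈ : P ∈ monicIrrDivisors A
        P∈ = irreducibleDivisors⁺ {deg A} {A}
          (monicOfDeg1to⁺ (MonicIrreducible.positive (irreducible⁻ m irr))
            (subst (_≤ deg A) (Monic⇒deg m) (∣⇒deg≤ P∣A A≉0)) m) irr P∣A

-- Finite sums in the coefficient field.

module FiniteSums (𝕂 : CharZeroField) where
  open CharZeroField 𝕂

  coefficientRing : CommutativeRing 0ℓ 0ℓ
  coefficientRing = record { isCommutativeRing = isCommutativeRing }

  module K where
    open CommutativeRing coefficientRing public
    open RingProperties ring public
    open CommutativeSemigroupProperties +-commutativeSemigroup public using (interchange)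

  Sum : {X : Set} → List X → (X → Carrier) → Carrier
  Sum xs f = sum (map f xs)

  indicator : Bool → Carrier
  indicator b = if b then 1# else 0#

  indicator-true : ∀ {b} → T b → indicator b ≡ 1#
  indicator-true {true} _ = refl

  module _ {X : Set} where

    Sum-cong : ∀ {f g : X → Carrier} xs → (∀ x → f x ≡ g x) → Sum xs f ≡ Sum xs g
    Sum-cong xs eq = cong sum (map-cong eq xs)

    Sum-cong-∈ : ∀ {f g : X → Carrier} xs → (∀ {x} → x ∈ xs → f x ≡ g x) → Sum xs f ≡ Sum xs g
    Sum-cong-∈ []       eq = refl
    Sum-cong-∈ (x ∷ xs) eq = cong₂ _+_ (eq (here refl)) (Sum-cong-∈ xs (eq ∘ there))

    Sum-+ : ∀ (f g : X → Carrier) xs → Sum xs (λ x → f x + g x) ≡ Sum xs f + Sum xs g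
    Sum-+ f g []       = sym (K.+-identityˡ 0#)
    Sum-+ f g (x ∷ xs) = trans (cong (f x + g x +_) (Sum-+ f g xs)) (K.interchange _ _ _ _)

    Sum-*ˡ : ∀ c (f : X → Carrier) xs → Sum xs (λ x → c * f x) ≡ c * Sum xs f
    Sum-*ˡ c f []       = sym (K.zeroʳ c)
    Sum-*ˡ c f (x ∷ xs) = trans (cong (c * f x +_) (Sum-*ˡ c f xs)) (sym (K.distribˡ _ _ _))

    Sum-0 : ∀ (xs : List X) → Sum xs (λ _ → 0#) ≡ 0#
    Sum-0 []       = refl
    Sum-0 (x ∷ xs) = trans (K.+-identityˡ _) (Sum-0 xs)

    Sum-const : ∀ c (xs : List X) → Sum xs (λ _ → c) ≡ fromℕ (length xs) * c
    Sum-const c []       = sym (K.zeroˡ c)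
    Sum-const c (x ∷ xs) = begin
      c + Sum xs (λ _ → c)              ≡⟨ cong₂ _+_ (sym (K.*-identityˡ c)) (Sum-const c xs) ⟩
      1# * c + fromℕ (length xs) * c    ≡⟨ K.distribʳ c 1# (fromℕ (length xs)) ⟨
      (1# + fromℕ (length xs)) * c      ∎
      where open ≡-Reasoning

    Sum-++ : ∀ (f : X → Carrier) xs ys → Sum (xs ++ ys) f ≡ Sum xs f + Sum ys f
    Sum-++ f []       ys = sym (K.+-identityˡ _)
    Sum-++ f (x ∷ xs) ys = trans (cong (f x +_) (Sum-++ f xs ys)) (sym (K.+-assoc _ _ _))

    Sum-filter : ∀ p (f : X → Carrier) xs →
                 Sum (filterᵇ p xs) f ≡ Sum xs (λ x → indicator (p x) * f x)
    Sum-filter p f [] = refl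
    Sum-filter p f (x ∷ xs) with p x
    ... | true  = cong₂ _+_ (sym (K.*-identityˡ (f x))) (Sum-filter p f xs)
    ... | false = trans (Sum-filter p f xs)
      (sym (trans (cong (_+ Sum xs (λ y → indicator (p y) * f y)) (K.zeroˡ (f x))) (K.+-identityˡ _)))

    Sum-single : ∀ {z} {f : X → Carrier} {xs} → Unique xs → z ∈ xs →
                 (∀ {x} → x ∈ xs → x ≢ z → f x ≡ 0#) → Sum xs f ≡ f z
    Sum-single {z} {f} {x ∷ xs} (x∉ ∷ _) (here refl) zeros = begin
      f x + Sum xs f            ≡⟨ cong (f x +_) (Sum-cong-∈ xs λ y∈ → zeros (there y∈) λ y≡x → All.lookup x∉ y∈ (sym y≡x)) ⟩
      f x + Sum xs (λ _ → 0#)   ≡⟨ cong (f x +_) (Sum-0 xs) ⟩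
      f x + 0#                  ≡⟨ K.+-identityʳ _ ⟩
      f x                       ∎
      where open ≡-Reasoning
    Sum-single {z} {f} {x ∷ xs} (x∉ ∷ uniq) (there z∈) zeros = trans
      (cong₂ _+_ (zeros (here refl) (All.lookup x∉ z∈)) (Sum-single uniq z∈ (zeros ∘ there)))
      (K.+-identityˡ _)

    Sum-↭ : ∀ (f : X → Carrier) {xs ys} → xs ↭ ys → Sum xs f ≡ Sum ys f
    Sum-↭ f p = foldr-commMonoid K.setoid K.+-isCommutativeMonoid (↭⇒↭ₛ (map⁺ f p))

  module _ {X Y : Set} where

    Sum-map : ∀ (g : X → Y) (f : Y → Carrier) xs → Sum (map g xs) f ≡ Sum xs (f ∘ g)
    Sum-map g f xs = cong sum (sym (map-∘ xs))

    Sum-concatMap : ∀ (g : X → List Y) (f : Y → Carrier) xs →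
                    Sum (concatMap g xs) f ≡ Sum xs (λ x → Sum (g x) f)
    Sum-concatMap g f []       = refl
    Sum-concatMap g f (x ∷ xs) =
      trans (Sum-++ f (g x) (concatMap g xs)) (cong (Sum (g x) f +_) (Sum-concatMap g f xs))

    Sum-swap : ∀ (f : X → Y → Carrier) xs ys →
               Sum xs (λ x → Sum ys (f x)) ≡ Sum ys (λ y → Sum xs (λ x → f x y))
    Sum-swap f []       ys = sym (Sum-0 ys)
    Sum-swap f (x ∷ xs) ys =
      trans (cong (Sum ys (f x) +_) (Sum-swap f xs ys)) (sym (Sum-+ (f x) _ ys))

  -- The image of the list under `σ` is again duplicate-free with the same members, hence a
  -- permutation of it.
  Sum-bijection : ∀ {X : Set} {xs : List X} → Unique xs → (∀ x → x ∈ xs) →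
                  (σ τ : X → X) → (∀ x → τ (σ x) ≡ x) → (∀ x → σ (τ x) ≡ x) →
                  ∀ f → Sum xs (f ∘ σ) ≡ Sum xs f
  Sum-bijection {xs = xs} uniq full σ τ τσ στ f = trans (sym (Sum-map σ f xs))
    (Sum-↭ f (∼bag⇒↭ (unique∧set⇒bag
      (Unique.map⁺ (λ {x} {y} e → trans (sym (τσ x)) (trans (cong τ e) (τσ y))) uniq) uniq
      (λ {x} → mk⇔ (λ _ → full x) (λ _ → subst (_∈ map σ xs) (στ x) (∈-map⁺ σ (full (τ x))))))))

  fromℕ-+ : ∀ m n → fromℕ (m ℕ.+ n) ≡ fromℕ m + fromℕ n
  fromℕ-+ zero    n = sym (K.+-identityˡ _)
  fromℕ-+ (suc m) n = trans (cong (1# +_) (fromℕ-+ m n)) (sym (K.+-assoc _ _ _))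

  fromℕ-* : ∀ m n → fromℕ (m ℕ.* n) ≡ fromℕ m * fromℕ n
  fromℕ-* zero    n = sym (K.zeroˡ _)
  fromℕ-* (suc m) n = begin
    fromℕ (n ℕ.+ m ℕ.* n)               ≡⟨ fromℕ-+ n (m ℕ.* n) ⟩
    fromℕ n + fromℕ (m ℕ.* n)           ≡⟨ cong₂ _+_ (sym (K.*-identityˡ _)) (fromℕ-* m n) ⟩
    1# * fromℕ n + fromℕ m * fromℕ n    ≡⟨ K.distribʳ _ _ _ ⟨
    (1# + fromℕ m) * fromℕ n            ∎
    where open ≡-Reasoning

-- Reindexing sums over all polynomials of bounded degree.

module PolynomialSums (𝔽 : FiniteField) (𝕂 : CharZeroField) where
  open FiniteField 𝔽
  open Poly 𝔽
  open PolynomialRing 𝔽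
  open EuclideanDivision 𝔽
  open Divisibility 𝔽
  open Irreducibles 𝔽
  open FiniteSums 𝕂
  private module 𝕂 = CharZeroField 𝕂

  -- Residues are enumerated as lists of a fixed length, while expressions such as `W ⊞ v` may have
  -- another length; a reindexing is valid only for summands blind to trailing zeros.
  Respects≈ : (Pol → 𝕂.Carrier) → Set
  Respects≈ f = ∀ {A B} → A ≈ B → f A ≡ f B

  ΣF : (Carrier → 𝕂.Carrier) → 𝕂.Carrier
  ΣF = Sum elements

  Σ< : ℕ → (Pol → 𝕂.Carrier) → 𝕂.Carrier
  Σ< d = Sum (allOfLength d)

  Σ<-cong : ∀ {f g} d → (∀ A → f A ≡ g A) → Σ< d f ≡ Σ< d g
  Σ<-cong d = Sum-cong (allOfLength d)

  ΣF-cong : ∀ {f g} → (∀ a → f a ≡ g a) → ΣF f ≡ ΣF g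
  ΣF-cong = Sum-cong elements

  Σ<-suc : ∀ d f → Σ< (suc d) f ≡ ΣF (λ c → Σ< d (λ v → f (c ∷ v)))
  Σ<-suc d f = trans (Sum-concatMap _ f elements)
    (ΣF-cong λ c → Sum-map (c ∷_) f (allOfLength d))

  ΣF-translate : ∀ b h → ΣF (λ c → h (b + c)) ≡ ΣF h
  ΣF-translate b = Sum-bijection unique complete (b +_) (- b +_)
    (λ x → trans (sym (F.+-assoc _ _ _)) (trans (cong (_+ x) (F.-‿inverseˡ b)) (F.+-identityˡ x)))
    (λ x → trans (sym (F.+-assoc _ _ _)) (trans (cong (_+ x) (F.-‿inverseʳ b)) (F.+-identityˡ x)))

  ΣF-scale : ∀ {l} → l ≢ 0# → ∀ h → ΣF (λ a → h (a * l)) ≡ ΣF h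
  ΣF-scale {l} l≢0 = Sum-bijection unique complete (_* l) (_* l ⁻¹)
    (λ x → trans (F.*-assoc _ _ _) (trans (cong (x *_) (inverseʳ l l≢0)) (F.*-identityʳ x)))
    (λ x → trans (F.*-assoc _ _ _)
      (trans (cong (x *_) (trans (F.*-comm _ _) (inverseʳ l l≢0))) (F.*-identityʳ x)))

  Σ<-translate : ∀ d {W f} → Below d W → Respects≈ f → Σ< d (λ v → f (W ⊞ v)) ≡ Σ< d f
  Σ<-translate zero    {W} b resp = cong (𝕂._+ 𝕂.0#) (resp (≈-trans (⊞-identityʳ W) (Below-zero b)))
  Σ<-translate (suc d) {[]}        b resp = refl
  Σ<-translate (suc d) {w ∷ W} {f} b resp = begin
    Σ< (suc d) (λ v → f ((w ∷ W) ⊞ v))               ≡⟨ Σ<-suc d _ ⟩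
    ΣF (λ c → Σ< d (λ v → f ((w + c) ∷ (W ⊞ v))))    ≡⟨ ΣF-cong (λ c → Σ<-translate d (Below-tail b) (resp ∘ ∷-cong refl)) ⟩
    ΣF (λ c → Σ< d (λ v → f ((w + c) ∷ v)))          ≡⟨ ΣF-translate w (λ c → Σ< d (λ v → f (c ∷ v))) ⟩
    ΣF (λ c → Σ< d (λ v → f (c ∷ v)))                ≡⟨ Σ<-suc d f ⟨
    Σ< (suc d) f                                     ∎
    where open ≡-Reasoning

  -- Since the leading coefficient of `C` is invertible, `a` times it runs through the field and
  -- supplies the coefficient of degree `c`; the lower coefficients of `scale a C` are absorbed by
  -- translation.
  Σ<-top : ∀ c {C f} → Degree c C → Respects≈ f →
           ΣF (λ a → Σ< c (λ r → f (scale a C ⊞ r))) ≡ Σ< (suc c) f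
  Σ<-top c       {[]}         (_ , c≢0) _ = contradiction refl c≢0
  Σ<-top zero    {l ∷ C} {f} (b , l≢0) resp = begin
    ΣF (λ a → f (scale a (l ∷ C) ⊞ []) 𝕂.+ 𝕂.0#)
      ≡⟨ ΣF-cong (λ a → cong (𝕂._+ 𝕂.0#) (resp (∷-cong refl (scale-cong refl (Below-zero (Below-tail b)))))) ⟩
    ΣF (λ a → f [ a * l ] 𝕂.+ 𝕂.0#)
      ≡⟨ ΣF-scale l≢0 (λ a → f [ a ] 𝕂.+ 𝕂.0#) ⟩
    ΣF (λ a → f [ a ] 𝕂.+ 𝕂.0#)
      ≡⟨ Σ<-suc 0 f ⟨
    Σ< 1 f ∎
    where open ≡-Reasoning
  Σ<-top (suc c) {l ∷ C} {f} (b , c≢0) resp = begin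
    ΣF (λ a → Σ< (suc c) (λ r → f (scale a (l ∷ C) ⊞ r)))
      ≡⟨ ΣF-cong (λ a → Σ<-suc c _) ⟩
    ΣF (λ a → ΣF (λ s → Σ< c (λ r → f ((a * l + s) ∷ (scale a C ⊞ r)))))
      ≡⟨ ΣF-cong (λ a → ΣF-translate (a * l) (λ s → Σ< c (λ r → f (s ∷ (scale a C ⊞ r))))) ⟩
    ΣF (λ a → ΣF (λ s → Σ< c (λ r → f (s ∷ (scale a C ⊞ r)))))
      ≡⟨ Sum-swap _ elements elements ⟩
    ΣF (λ s → ΣF (λ a → Σ< c (λ r → f (s ∷ (scale a C ⊞ r)))))
      ≡⟨ ΣF-cong (λ s → Σ<-top c (Below-tail b , c≢0) (resp ∘ ∷-cong refl)) ⟩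
    ΣF (λ s → Σ< (suc c) (λ v → f (s ∷ v)))
      ≡⟨ Σ<-suc (suc c) f ⟨
    Σ< (suc (suc c)) f ∎
    where open ≡-Reasoning

  -- Division with remainder by C as a reindexing of the polynomials of degree < n + deg C.
  Σ<-division : ∀ n {c C f} → Degree c C → Respects≈ f →
                Σ< n (λ D → Σ< c (λ r → f (D ⊠ C ⊞ r))) ≡ Σ< (n ℕ.+ c) f
  Σ<-division zero    _ _ = K.+-identityʳ _
  Σ<-division (suc n) {c} {C} {f} degC resp = begin
    Σ< (suc n) (λ D → Σ< c (λ r → f (D ⊠ C ⊞ r)))
      ≡⟨ Σ<-suc n _ ⟩
    ΣF (λ a → Σ< n (λ D → Σ< c (λ r → f (scale a C ⊞ (0# ∷ D ⊠ C) ⊞ r))))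
      ≡⟨ Sum-swap _ elements (allOfLength n) ⟩
    Σ< n (λ D → ΣF (λ a → Σ< c (λ r → f (scale a C ⊞ (0# ∷ D ⊠ C) ⊞ r))))
      ≡⟨ Σ<-cong n (λ D → ΣF-cong λ a → Σ<-cong c λ r → resp (rearrange (scale a C) (0# ∷ D ⊠ C) r)) ⟩
    Σ< n (λ D → ΣF (λ a → Σ< c (λ r → f ((0# ∷ D ⊠ C) ⊞ (scale a C ⊞ r)))))
      -- The lowest coefficient `a` of the quotient and the remainder `r` combine into an arbitrary
      -- polynomial of degree at most `c`. Splitting off its constant coefficient next leaves a
      -- division for a quotient with one coefficient fewer.
      ≡⟨ Σ<-cong n (λ D → Σ<-top c degC (resp ∘ ⊞-cong {0# ∷ D ⊠ C} ≈-refl)) ⟩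
    Σ< n (λ D → Σ< (suc c) (λ s → f ((0# ∷ D ⊠ C) ⊞ s)))
      ≡⟨ Σ<-cong n (λ D → Σ<-suc c _) ⟩
    Σ< n (λ D → ΣF (λ s → Σ< c (λ r → f ((0# + s) ∷ (D ⊠ C ⊞ r)))))
      -- Adding the list heads leaves `0# + s`; translation by zero removes it under the sum.
      ≡⟨ Σ<-cong n (λ D → ΣF-translate 0# (λ s → Σ< c (λ r → f (s ∷ (D ⊠ C ⊞ r))))) ⟩
    Σ< n (λ D → ΣF (λ s → Σ< c (λ r → f (s ∷ (D ⊠ C ⊞ r)))))
      ≡⟨ Sum-swap _ (allOfLength n) elements ⟩
    ΣF (λ s → Σ< n (λ D → Σ< c (λ r → f (s ∷ (D ⊠ C ⊞ r)))))
      ≡⟨ ΣF-cong (λ s → Σ<-division n degC (resp ∘ ∷-cong refl)) ⟩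
    ΣF (λ s → Σ< (n ℕ.+ c) (λ v → f (s ∷ v)))
      ≡⟨ Σ<-suc (n ℕ.+ c) f ⟨
    Σ< (suc n ℕ.+ c) f ∎
    where
    open ≡-Reasoning
    rearrange : ∀ X Y Z → X ⊞ Y ⊞ Z ≈ Y ⊞ (X ⊞ Z)
    rearrange X Y Z = ≈-trans (⊞-cong (⊞-comm X Y) ≈-refl) (⊞-assoc Y X Z)

  Σ<-one : ∀ d → Σ< d (λ _ → 𝕂.1#) ≡ 𝕂.fromℕ (q ℕ.^ d)
  Σ<-one zero    = refl
  Σ<-one (suc d) = begin
    Σ< (suc d) (λ _ → 𝕂.1#)         ≡⟨ Σ<-suc d _ ⟩
    ΣF (λ _ → Σ< d (λ _ → 𝕂.1#))    ≡⟨ ΣF-cong (λ _ → Σ<-one d) ⟩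
    ΣF (λ _ → 𝕂.fromℕ (q ℕ.^ d))    ≡⟨ Sum-const _ elements ⟩
    𝕂.fromℕ q 𝕂.* 𝕂.fromℕ (q ℕ.^ d) ≡⟨ fromℕ-* q (q ℕ.^ d) ⟨
    𝕂.fromℕ (q ℕ.^ suc d)           ∎
    where open ≡-Reasoning

  -- A nonzero multiple of `C` has degree at least `c`, so only zero survives, enumerated here as
  -- the list of `c` zeros and not as `[]`.
  Σ<-multiples : ∀ {c C g} → Degree c C → Respects≈ g →
                 Σ< c (λ r → indicator (divides C r) 𝕂.* g r) ≡ g []
  Σ<-multiples {c} {C} {g} degC resp = trans
    (Sum-single (allOfLength-unique c) zeros∈ others)
    (trans (cong₂ 𝕂._*_ (indicator-true (∣⇒divides C≉0 (∣-respʳ (≈-sym (zeros≈[] c)) ∣-[])))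
                        (resp (zeros≈[] c)))
           (K.*-identityˡ _))
    where
    C≉0 : ¬ C ≈ []
    C≉0 = Degree⇒≉0 degC
    zeros : ℕ → Pol
    zeros n = replicate n 0#
    zeros≈[] : ∀ n → zeros n ≈ []
    zeros≈[] zero    = ≈-refl
    zeros≈[] (suc n) = 0∷[]≈[] (zeros≈[] n)
    zeros∈ : zeros c ∈ allOfLength c
    zeros∈ = subst (λ n → zeros c ∈ allOfLength n) (length-replicate c) (allOfLength⁺ (zeros c))
    others : ∀ {r} → r ∈ allOfLength c → r ≢ zeros c → indicator (divides C r) 𝕂.* g r ≡ 𝕂.0#
    others {r} r∈ r≢0 with divides C r in eq
    ... | false = K.zeroˡ _
    ... | true  = contradiction (≈∧length⇒≡ r (zeros c)
          (trans (allOfLength⁻ c r∈) (sym (length-replicate c))) (≈-trans r≈[] (≈-sym (zeros≈[] c)))) r≢0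
      where
      r≈[] : r ≈ []
      r≈[] with r ≈[]?
      ... | yes p = p
      ... | no r≉0 = contradiction
        (ℕ.≤-trans (ℕ.≤-reflexive (sym (Degree⇒deg degC)))
          (∣⇒deg≤ (divides⇒∣ C≉0 (subst T (sym eq) _)) r≉0))
        (ℕ.<⇒≱ (Below⇒< (subst (λ n → Below n r) (allOfLength⁻ c r∈) (Below-length r))
                        (leading (degree r≉0))))

-- Additive characters modulo `H` and their orthogonality.

module RamanujanSums (𝔽 : FiniteField) (𝕂 : CharZeroField) (χ : AddChar 𝔽 𝕂) where
  open Ramanujan 𝔽 𝕂 χ
  open PolynomialRing 𝔽
  open EuclideanDivision 𝔽
  open Divisibility 𝔽
  open Irreducibles 𝔽
  open Radical 𝔽
  open CharZeroField 𝕂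
  open FiniteSums 𝕂
  open PolynomialSums 𝔽 𝕂
  open AddChar χ
  private
    module 𝔽 = FiniteField 𝔽
    module PS = SemiringSolver P.commutativeSemiring

  cancel-factor : ∀ {x s} → x ≢ 1# → s ≡ x * s → s ≡ 0#
  cancel-factor {x} {s} x≢1 s≡xs = begin
    s                                ≡⟨ K.*-identityˡ s ⟨
    1# * s                           ≡⟨ cong (_* s) (inverseʳ (x + - 1#) y≢0) ⟨
    y * y ⁻¹ * s                     ≡⟨ cong (_* s) (K.*-comm y (y ⁻¹)) ⟩
    y ⁻¹ * y * s                     ≡⟨ K.*-assoc _ _ _ ⟩
    y ⁻¹ * (y * s)                   ≡⟨ cong (y ⁻¹ *_) ys≡0 ⟩
    y ⁻¹ * 0#                        ≡⟨ K.zeroʳ _ ⟩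
    0#                               ∎
    where
    open ≡-Reasoning
    y : Carrier
    y = x + - 1#
    y≢0 : y ≢ 0#
    y≢0 e = x≢1 (K.x∙y⁻¹≈ε⇒x≈y x 1# e)
    ys≡0 : y * s ≡ 0#
    ys≡0 = begin
      (x + - 1#) * s      ≡⟨ K.distribʳ s x (- 1#) ⟩
      x * s + - 1# * s    ≡⟨ cong₂ _+_ (sym s≡xs) (K.-1*x≈-x s) ⟩
      s + - s             ≡⟨ K.-‿inverseʳ s ⟩
      0#                  ∎

  ψ-0 : ψ 𝔽.0# ≡ 1#
  ψ-0 = begin
    ψ 𝔽.0#                          ≡⟨ K.*-identityʳ _ ⟨
    ψ 𝔽.0# * 1#                     ≡⟨ cong (ψ 𝔽.0# *_) inv ⟨
    ψ 𝔽.0# * (ψ 𝔽.0# * ψ 𝔽.0# ⁻¹)   ≡⟨ K.*-assoc _ _ _ ⟨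
    ψ 𝔽.0# * ψ 𝔽.0# * ψ 𝔽.0# ⁻¹     ≡⟨ cong (_* ψ 𝔽.0# ⁻¹) (hom 𝔽.0# 𝔽.0#) ⟨
    ψ (𝔽.0# 𝔽.+ 𝔽.0#) * ψ 𝔽.0# ⁻¹   ≡⟨ cong (λ a → ψ a * ψ 𝔽.0# ⁻¹) (F.+-identityˡ 𝔽.0#) ⟩
    ψ 𝔽.0# * ψ 𝔽.0# ⁻¹              ≡⟨ inv ⟩
    1#                              ∎
    where
    open ≡-Reasoning
    inv : ψ 𝔽.0# * ψ 𝔽.0# ⁻¹ ≡ 1#
    inv = inverseʳ _ (nonzero 𝔽.0#)

  monomial : ℕ → 𝔽.Carrier → Pol
  monomial zero    a = [ a ]
  monomial (suc j) a = 𝔽.0# ∷ monomial j a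

  monomial-below : ∀ j a → Below (suc j) (monomial j a)
  monomial-below zero    a = Below-length [ a ]
  monomial-below (suc j) a = Below-∷ 𝔽.0# (monomial-below j a)

  coeff-monomial : ∀ j a → coeff j (monomial j a) ≡ a
  coeff-monomial zero    a = refl
  coeff-monomial (suc j) a = coeff-monomial j a

  indicator-∧ : ∀ a b → indicator (a ∧ b) ≡ indicator a * indicator b
  indicator-∧ true  b = sym (K.*-identityˡ _)
  indicator-∧ false b = sym (K.zeroˡ _)

  module _ {H : Pol} (H≉0 : ¬ H ≈ []) where

    rem-⊞ : ∀ A B → rem H (A ⊞ B) ≈ rem H A ⊞ rem H B
    rem-⊞ A B = rem-unique H≉0 {Q = quot H A ⊞ quot H B}
      (≈-trans (⊞-cong (equation (division H≉0 A)) (equation (division H≉0 B)))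
         (PS.solve 5 (λ x y h r s → ((x PS.:* h) PS.:+ r) PS.:+ ((y PS.:* h) PS.:+ s)
                              PS.:= ((x PS.:+ y) PS.:* h) PS.:+ (r PS.:+ s)) ≈-refl
           (quot H A) (quot H B) H (rem H A) (rem H B)) ,
       Below-⊞ (small (division H≉0 A)) (small (division H≉0 B)))

    t-cong : ∀ {A B} → A ≈ B → t H A ≡ t H B
    t-cong p = cong (λ c → if deg H ≡ᵇ 0 then 𝔽.0# else c) (at (rem-cong H≉0 p) (deg H ∸ 1))

    t-⊞ : ∀ A B → t H (A ⊞ B) ≡ t H A 𝔽.+ t H B
    t-⊞ A B = additive (deg H ≡ᵇ 0)
      (trans (at (rem-⊞ A B) (deg H ∸ 1)) (coeff-⊞ (deg H ∸ 1) (rem H A) (rem H B)))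
      where
      additive : ∀ b {x y z} → x ≡ y 𝔽.+ z →
        (if b then 𝔽.0# else x) ≡ (if b then 𝔽.0# else y) 𝔽.+ (if b then 𝔽.0# else z)
      additive true  _ = sym (F.+-identityˡ 𝔽.0#)
      additive false e = e

    t-∣ : ∀ {A} → H ∣ₚ A → t H A ≡ 𝔽.0#
    t-∣ {A} (cofactor {Q} p) = vanishing (deg H ≡ᵇ 0)
      (at (rem-unique H≉0 {Q = Q} {R = []} (≈-trans (≈-sym p) (≈-sym (⊞-identityʳ (Q ⊠ H))) , Below-[])) (deg H ∸ 1))
      where
      vanishing : ∀ b {x} → x ≡ 𝔽.0# → (if b then 𝔽.0# else x) ≡ 𝔽.0#
      vanishing true  _ = refl
      vanishing false e = e

    ψt : Pol → Carrier
    ψt A = ψ (t H A)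

    ψt-cong : Respects≈ ψt
    ψt-cong p = cong ψ (t-cong p)

    ψt-⊞ : ∀ A B → ψt (A ⊞ B) ≡ ψt A * ψt B
    ψt-⊞ A B = trans (cong ψ (t-⊞ A B)) (hom (t H A) (t H B))

    ψt-∣ : ∀ {A} → H ∣ₚ A → ψt A ≡ 1#
    ψt-∣ d = trans (cong ψ (t-∣ d)) ψ-0

    module _ {C M : Pol} (H≈ : H ≈ C ⊠ M) where
      private
        C≉0 : ¬ C ≈ []
        C≉0 = factorˡ-nonzero {C} {M} (≈-sym H≈) H≉0
        M≉0 : ¬ M ≈ []
        M≉0 = factorʳ-nonzero {C} {M} (≈-sym H≈) H≉0
        degH≡ : deg H ≡ deg M ℕ.+ deg C
        degH≡ = trans (deg-cong H (C ⊠ M) H≈) (trans (deg-⊠ {C} {M} C≉0 M≉0) (ℕ.+-comm (deg C) (deg M)))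

      -- D is the monomial that brings the leading coefficient of (A mod M) C D into degree deg H − 1.
      detects-nondivisibility : ∀ {A} → ¬ M ∣ₚ A →
        ∃ λ D → Below (deg M) D × ψt (A ⊠ (D ⊠ C)) ≢ 1#
      detects-nondivisibility {A} M∤A = D , D<m , λ e → proj₂ nontrivial (trans (cong ψ (sym t≡a₀)) e)
        where
        a₀ = proj₁ nontrivial
        R = rem M A
        R≉0 : ¬ R ≈ []
        R≉0 p = M∤A (cofactor {quotient = quot M A} (≈-sym (≈-trans (equation (division M≉0 A))
          (≈-trans (⊞-cong {quot M A ⊠ M} ≈-refl p) (⊞-identityʳ (quot M A ⊠ M))))))
        k = deg R
        c = deg C
        k<m : k < deg M
        k<m = Below⇒< (small (division M≉0 A)) (leading (degree R≉0))
        j = deg M ∸ suc k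
        lR = coeff k R
        lC = coeff c C
        -- Scaled so that `t` takes exactly the value `a₀`, at which `ψ` differs from 1.
        a = a₀ 𝔽.* (lR 𝔽.* lC) 𝔽.⁻¹
        D = monomial j a
        D<m : Below (deg M) D
        D<m = Below-mono (subst (suc j ≤_) (ℕ.m∸n+n≡m k<m) (ℕ.≤-trans (ℕ.≤-reflexive (ℕ.+-comm 1 j)) (ℕ.+-monoʳ-≤ j (s≤s z≤n)))) (monomial-below j a)
        DC<  : Below (suc (j ℕ.+ c)) (D ⊠ C)
        DC< = Below-⊠ D C (monomial-below j a) (bounded (degree C≉0))
        degH≡′ : deg H ≡ suc (k ℕ.+ (j ℕ.+ c))
        degH≡′ = trans degH≡ (trans (cong (ℕ._+ c) (sym (ℕ.m+[n∸m]≡n k<m))) (cong suc (ℕ.+-assoc k j c)))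
        -- Replacing `A` by `R` changes the product by a multiple of `C M = H`, and `R D C` already
        -- has degree below `deg H`, so it is the remainder and its coefficients can be read off.
        remainder : Division (A ⊠ (D ⊠ C)) H (quot M A ⊠ D) (R ⊠ (D ⊠ C))
        remainder =
          (begin
            A ⊠ (D ⊠ C)
              ≈⟨ ⊠-cong {B = D ⊠ C} (equation (division M≉0 A)) ≈-refl ⟩
            (quot M A ⊠ M ⊞ R) ⊠ (D ⊠ C)
              ≈⟨ PS.solve 5 (λ x m r d e → ((x PS.:* m) PS.:+ r) PS.:* (d PS.:* e)
                   PS.:= ((x PS.:* d) PS.:* (e PS.:* m)) PS.:+ (r PS.:* (d PS.:* e))) ≈-refl (quot M A) M R D C ⟩
            quot M A ⊠ D ⊠ (C ⊠ M) ⊞ R ⊠ (D ⊠ C)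
              ≈⟨ ⊞-cong (⊠-congʳ (quot M A ⊠ D) (≈-sym H≈)) ≈-refl ⟩
            quot M A ⊠ D ⊠ H ⊞ R ⊠ (D ⊠ C) ∎) ,
          subst (λ n → Below n (R ⊠ (D ⊠ C))) (sym degH≡′) (Below-⊠ R (D ⊠ C) (bounded (degree R≉0)) DC<)
          where open ≈-Reasoning
        t≡coeff : ∀ {n} X → deg H ≡ suc n → t H X ≡ coeff n (rem H X)
        t≡coeff X e = cong (λ m → if m ≡ᵇ 0 then 𝔽.0# else coeff (m ∸ 1) (rem H X)) e
        t≡a₀ : t H (A ⊠ (D ⊠ C)) ≡ a₀
        t≡a₀ = begin
          t H (A ⊠ (D ⊠ C))                                ≡⟨ t≡coeff (A ⊠ (D ⊠ C)) degH≡′ ⟩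
          coeff (k ℕ.+ (j ℕ.+ c)) (rem H (A ⊠ (D ⊠ C)))    ≡⟨ at (rem-unique H≉0 remainder) _ ⟩
          coeff (k ℕ.+ (j ℕ.+ c)) (R ⊠ (D ⊠ C))            ≡⟨ coeff-⊠ k (j ℕ.+ c) R (D ⊠ C) (bounded (degree R≉0)) DC< ⟩
          lR 𝔽.* coeff (j ℕ.+ c) (D ⊠ C)                   ≡⟨ cong (lR 𝔽.*_) (coeff-⊠ j c D C (monomial-below j a) (bounded (degree C≉0))) ⟩
          lR 𝔽.* (coeff j D 𝔽.* lC)                        ≡⟨ cong (λ x → lR 𝔽.* (x 𝔽.* lC)) (coeff-monomial j a) ⟩
          lR 𝔽.* (a 𝔽.* lC)                                ≡⟨ cong (lR 𝔽.*_) (F.*-comm a lC) ⟩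
          lR 𝔽.* (lC 𝔽.* a)                                ≡⟨ F.*-assoc _ _ _ ⟨
          lR 𝔽.* lC 𝔽.* a                                  ≡⟨ F.*-comm _ _ ⟩
          a₀ 𝔽.* (lR 𝔽.* lC) 𝔽.⁻¹ 𝔽.* (lR 𝔽.* lC)          ≡⟨ F.*-assoc _ _ _ ⟩
          a₀ 𝔽.* ((lR 𝔽.* lC) 𝔽.⁻¹ 𝔽.* (lR 𝔽.* lC))        ≡⟨ cong (a₀ 𝔽.*_) (trans (F.*-comm _ _)
                                                                (𝔽.inverseʳ _ (*-nonzero (leading (degree R≉0)) (leading (degree C≉0))))) ⟩
          a₀ 𝔽.* 𝔽.1#                                      ≡⟨ F.*-identityʳ a₀ ⟩
          a₀                                               ∎
          where open ≡-Reasoning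

      twisted-sum-∣ : ∀ {A} → M ∣ₚ A → Σ< (deg M) (λ D → ψt (A ⊠ (D ⊠ C))) ≡ fromℕ ∣ M ∣
      twisted-sum-∣ {A} (cofactor {Q} p) =
        trans (Σ<-cong (deg M) (λ D → ψt-∣ (H∣ D))) (Σ<-one (deg M))
        where
        H∣ : ∀ D → H ∣ₚ A ⊠ (D ⊠ C)
        H∣ D = cofactor {quotient = Q ⊠ D} (≈-trans
          (⊠-congʳ (Q ⊠ D) H≈)
          (≈-trans (PS.solve 4 (λ x d e m → (x PS.:* d) PS.:* (e PS.:* m) PS.:= (x PS.:* m) PS.:* (d PS.:* e)) ≈-refl Q D C M)
            (⊠-cong {B = D ⊠ C} p ≈-refl)))

      -- Averaging argument: translating the summation variable by a `D₀` with `f D₀ ≢ 1#`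
      -- multiplies the sum by `f D₀` while leaving it unchanged.
      twisted-sum-∤ : ∀ {A} → ¬ M ∣ₚ A → Σ< (deg M) (λ D → ψt (A ⊠ (D ⊠ C))) ≡ 0#
      twisted-sum-∤ {A} M∤A = translate (detects-nondivisibility M∤A)
        where
        open ≡-Reasoning
        f : Pol → Carrier
        f D = ψt (A ⊠ (D ⊠ C))
        f-resp : Respects≈ f
        f-resp p = ψt-cong (⊠-congʳ A (⊠-cong {B = C} p ≈-refl))
        f-⊞ : ∀ D₀ D → f (D₀ ⊞ D) ≡ f D₀ * f D
        f-⊞ D₀ D = trans (ψt-cong (≈-trans (⊠-congʳ A (⊠-distribʳ C D₀ D)) (⊠-distribˡ A (D₀ ⊠ C) (D ⊠ C))))
          (ψt-⊞ (A ⊠ (D₀ ⊠ C)) (A ⊠ (D ⊠ C)))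
        translate : (∃ λ D₀ → Below (deg M) D₀ × f D₀ ≢ 1#) → Σ< (deg M) f ≡ 0#
        translate (D₀ , D₀<m , f≢1) = cancel-factor f≢1 (begin
          Σ< (deg M) f                        ≡⟨ Σ<-translate (deg M) D₀<m f-resp ⟨
          Σ< (deg M) (λ D → f (D₀ ⊞ D))       ≡⟨ Σ<-cong (deg M) (f-⊞ D₀) ⟩
          Σ< (deg M) (λ D → f D₀ * f D)       ≡⟨ Sum-*ˡ (f D₀) f (allOfLength (deg M)) ⟩
          f D₀ * Σ< (deg M) f                 ∎)

      orthogonality : ∀ A → Σ< (deg M) (λ D → ψt (A ⊠ (D ⊠ C))) ≡
                            indicator (divides M A) * fromℕ ∣ M ∣
      orthogonality A = by-cases (divides M A)
        (λ d → twisted-sum-∣ {A} (divides⇒∣ M≉0 d)) (λ ¬d → twisted-sum-∤ {A} (¬d ∘ ∣⇒divides M≉0))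
        where
        by-cases : ∀ b {x n} → (T b → x ≡ n) → (¬ T b → x ≡ 0#) → x ≡ indicator b * n
        by-cases true  p _ = trans (p _) (sym (K.*-identityˡ _))
        by-cases false _ p = trans (p λ ()) (sym (K.zeroˡ _))

      divides-⊞-multiple : ∀ D r → divides C (D ⊠ C ⊞ r) ≡ divides C r
      divides-⊞-multiple D r = divides-ext C≉0 C≉0
        (λ d → ∣-respʳ cancel (∣-⊞ (cofactor {quotient = ⊟ D} ≈-refl) d))
        (∣-⊞ (cofactor {quotient = D} ≈-refl))
        where
        cancel : ⊟ D ⊠ C ⊞ (D ⊠ C ⊞ r) ≈ r
        cancel = ≈-trans (≈-sym (⊞-assoc (⊟ D ⊠ C) (D ⊠ C) r))
          (⊞-cong {A′ = []} (≈-trans (≈-sym (⊠-distribʳ C (⊟ D) D)) (⊠-cong {B = C} (⊟-inverseˡ D) ≈-refl)) ≈-refl)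

      -- Writing each residue as `D C + r`, divisibility by `C` is a condition on `r` alone and
      -- singles out `r = 0`; what remains is a full character sum modulo `M`.
      sum-over-multiples : ∀ A → Σ< (deg H) (λ D → indicator (divides C D) * ψt (A ⊠ D)) ≡
                                 indicator (divides M A) * fromℕ ∣ M ∣
      sum-over-multiples A = begin
        Σ< (deg H) f
          ≡⟨ cong (λ n → Σ< n f) degH≡ ⟩
        Σ< (deg M ℕ.+ deg C) f
          ≡⟨ Σ<-division (deg M) (degree C≉0) f-resp ⟨
        Σ< (deg M) (λ D → Σ< (deg C) (λ r → f (D ⊠ C ⊞ r)))
          ≡⟨ Σ<-cong (deg M) (λ D → Σ<-cong (deg C) λ r →
               cong (λ b → indicator b * ψt (A ⊠ (D ⊠ C ⊞ r))) (divides-⊞-multiple D r)) ⟩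
        Σ< (deg M) (λ D → Σ< (deg C) (λ r → indicator (divides C r) * ψt (A ⊠ (D ⊠ C ⊞ r))))
          ≡⟨ Σ<-cong (deg M) (λ D → Σ<-multiples (degree C≉0)
               (λ p → ψt-cong (⊠-congʳ A (⊞-cong {D ⊠ C} ≈-refl p)))) ⟩
        Σ< (deg M) (λ D → ψt (A ⊠ (D ⊠ C ⊞ [])))
          ≡⟨ Σ<-cong (deg M) (λ D → ψt-cong (⊠-congʳ A (⊞-identityʳ (D ⊠ C)))) ⟩
        Σ< (deg M) (λ D → ψt (A ⊠ (D ⊠ C)))
          ≡⟨ orthogonality A ⟩
        indicator (divides M A) * fromℕ ∣ M ∣ ∎
        where
        open ≡-Reasoning
        f : Pol → Carrier
        f D = indicator (divides C D) * ψt (A ⊠ D)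
        f-resp : Respects≈ f
        f-resp p = cong₂ (λ b x → indicator b * x)
          (divides-ext C≉0 C≉0 (∣-respʳ p) (∣-respʳ (≈-sym p))) (ψt-cong (⊠-congʳ A p))

-- The sieve, the product formula, and its symmetry.

module ProductFormula (𝔽 : FiniteField) (𝕂 : CharZeroField) (χ : AddChar 𝔽 𝕂) where
  open Ramanujan 𝔽 𝕂 χ
  open PolynomialRing 𝔽
  open EuclideanDivision 𝔽
  open Divisibility 𝔽
  open Irreducibles 𝔽
  open Radical 𝔽
  open CharZeroField 𝕂
  open FiniteSums 𝕂
  open PolynomialSums 𝔽 𝕂
  open RamanujanSums 𝔽 𝕂 χ
  private
    module 𝔽 = FiniteField 𝔽
    module PS = SemiringSolver P.commutativeSemiring
    module KS = SemiringSolver K.commutativeSemiring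

  Product : (Pol → Carrier) → List Pol → Carrier
  Product f = foldr (λ P x → f P * x) 1#

  -- For irreducible `P` this is the value of the Ramanujan sum `η G P`: the complete character sum
  -- modulo `P` minus its term 1 at residue 0.
  localFactor : Pol → Pol → Carrier
  localFactor G P = fromℕ ∣ P ∣ * indicator (divides P G) + - 1#

  -- Inclusion-exclusion for a single prime. The sign is kept as a factor `- 1#`, so that the
  -- semiring solver can later treat it as a variable.
  indicator-not-∧ : ∀ a b → indicator (not a ∧ b) ≡ indicator b + - 1# * (indicator a * indicator b)
  indicator-not-∧ true  b = sym (trans
    (cong (indicator b +_) (trans (cong (- 1# *_) (K.*-identityˡ _)) (K.-1*x≈-x _))) (K.-‿inverseʳ _))
  indicator-not-∧ false b = sym (trans
    (cong (indicator b +_) (trans (cong (- 1# *_) (K.zeroˡ _)) (K.zeroʳ _))) (K.+-identityʳ _))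

  norm-multiplicative : ∀ {A B} → ¬ A ≈ [] → ¬ B ≈ [] →
                        fromℕ ∣ A ⊠ B ∣ ≡ fromℕ ∣ A ∣ * fromℕ ∣ B ∣
  norm-multiplicative {A} {B} A≉0 B≉0 = trans
    (cong fromℕ (trans (cong (𝔽.q ℕ.^_) (deg-⊠ {A} {B} A≉0 B≉0)) (ℕ.^-distribˡ-+-* 𝔽.q (deg A) (deg B))))
    (fromℕ-* ∣ A ∣ ∣ B ∣)

  indicator-divides-⊠ : ∀ {A B} X → ¬ A ≈ [] → ¬ B ≈ [] → Comaximal A B →
    indicator (divides (A ⊠ B) X) ≡ indicator (divides A X) * indicator (divides B X)
  indicator-divides-⊠ {A} {B} X A≉0 B≉0 com = trans (cong indicator (T-ext
      (λ d → let AB∣X = divides⇒∣ (⊠-nonzero A≉0 B≉0) {X} d in Equivalence.from (T-∧ {divides A X})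
        (∣⇒divides A≉0 (∣-trans (∣-⊠ʳ B ∣-refl) AB∣X) ,
         ∣⇒divides B≉0 (∣-trans (∣-⊠ˡ A ∣-refl) AB∣X)))
      (λ t → let a , b = Equivalence.to (T-∧ {divides A X}) t in
        ∣⇒divides (⊠-nonzero A≉0 B≉0) {X}
          (comaximal-product-∣ com (divides⇒∣ A≉0 {X} a) (divides⇒∣ B≉0 {X} b)))))
    (indicator-∧ (divides A X) (divides B X))

  divides-one : ∀ A → T (divides one A)
  divides-one A = ∣⇒divides one≉0 (cofactor {quotient = A} (⊠-identityʳ A))

  module _ {H : Pol} (H≉0 : ¬ H ≈ []) (G S : Pol) where

    sieved : List Pol → Pol → Carrier
    sieved Ps D = indicator (all (λ P → not (divides P D)) Ps) * ψt H≉0 (G ⊠ S ⊠ D)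

    -- The primes of Ps are removed one at a time; each P moves either to N (no condition on D)
    -- or to C (P divides D).
    sieve : ∀ Ps C N → All MonicIrreducible Ps → AllPairs Comaximal Ps →
            All (λ P → Comaximal C P) Ps → All (λ P → Comaximal N P) Ps →
            H ≈ C ⊠ (prod Ps ⊠ (N ⊠ S)) →
            Σ< (deg H) (λ D → indicator (divides C D) * sieved Ps D) ≡
            fromℕ ∣ S ∣ * (indicator (divides N G) * fromℕ ∣ N ∣) * Product (localFactor G) Ps
    sieve [] C N _ _ _ _ H≈ = begin
      Σ< (deg H) (λ D → indicator (divides C D) * (1# * ψt H≉0 (G ⊠ S ⊠ D)))
        ≡⟨ Σ<-cong (deg H) (λ D → cong (indicator (divides C D) *_) (K.*-identityˡ _)) ⟩
      Σ< (deg H) (λ D → indicator (divides C D) * ψt H≉0 (G ⊠ S ⊠ D))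
        ≡⟨ sum-over-multiples H≉0 {C} {N ⊠ S} H≈′ (G ⊠ S) ⟩
      indicator (divides (N ⊠ S) (G ⊠ S)) * fromℕ ∣ N ⊠ S ∣
        ≡⟨ cong₂ (λ b x → indicator b * x)
             (divides-ext {A′ = G} NS≉0 N≉0 (⊠-cancel-∣ S S≉0) (⊠-mono-∣ S)) (norm-multiplicative N≉0 S≉0) ⟩
      indicator (divides N G) * (fromℕ ∣ N ∣ * fromℕ ∣ S ∣)
        ≡⟨ KS.solve 3 (λ i n s → i KS.:* (n KS.:* s) KS.:= s KS.:* (i KS.:* n)) refl
             (indicator (divides N G)) (fromℕ ∣ N ∣) (fromℕ ∣ S ∣) ⟩
      fromℕ ∣ S ∣ * (indicator (divides N G) * fromℕ ∣ N ∣)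
        ≡⟨ K.*-identityʳ _ ⟨
      fromℕ ∣ S ∣ * (indicator (divides N G) * fromℕ ∣ N ∣) * 1# ∎
      where
      open ≡-Reasoning
      H≈′ : H ≈ C ⊠ (N ⊠ S)
      H≈′ = ≈-trans H≈ (⊠-congʳ C (⊠-identityˡ (N ⊠ S)))
      NS≉0 : ¬ N ⊠ S ≈ []
      NS≉0 = factorʳ-nonzero {C} (≈-sym H≈′) H≉0
      N≉0 : ¬ N ≈ []
      N≉0 = factorˡ-nonzero {N} {S} ≈-refl NS≉0
      S≉0 : ¬ S ≈ []
      S≉0 = factorʳ-nonzero {N} {S} ≈-refl NS≉0
    sieve (P ∷ Ps) C N (irr ∷ irrs) (P⊥Ps ∷ Ps⊥) (C⊥P ∷ C⊥Ps) (N⊥P ∷ N⊥Ps) H≈ = begin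
      Σ< (deg H) (λ D → indicator (divides C D) * sieved (P ∷ Ps) D)
        ≡⟨ Σ<-cong (deg H) split ⟩
      Σ< (deg H) (λ D → indicator (divides C D) * sieved Ps D
                        + - 1# * (indicator (divides (C ⊠ P) D) * sieved Ps D))
        ≡⟨ Sum-+ _ _ (allOfLength (deg H)) ⟩
      Σ< (deg H) (λ D → indicator (divides C D) * sieved Ps D)
        + Σ< (deg H) (λ D → - 1# * (indicator (divides (C ⊠ P) D) * sieved Ps D))
        ≡⟨ cong₂ _+_
             (sieve Ps C (P ⊠ N) irrs Ps⊥ C⊥Ps (⊠⊥ P⊥Ps N⊥Ps) H≈₁)
             (trans (Sum-*ˡ (- 1#) _ (allOfLength (deg H)))
               (cong (- 1# *_) (sieve Ps (C ⊠ P) N irrs Ps⊥ (⊠⊥ C⊥Ps P⊥Ps) N⊥Ps H≈₂))) ⟩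
      s * (indicator (divides (P ⊠ N) G) * fromℕ ∣ P ⊠ N ∣) * Π
        + - 1# * (s * (iN * n) * Π)
        -- Comaximality of `P` and `N` splits the indicator. The two branches then differ only in
        -- `p * iP` against `- 1#`, whose sum is the local factor at `P`.
        ≡⟨ cong₂ (λ x y → s * (x * y) * Π + - 1# * (s * (iN * n) * Π))
             (indicator-divides-⊠ G P≉0 N≉0 (comaximal-sym N⊥P)) (norm-multiplicative P≉0 N≉0) ⟩
      s * (iP * iN * (p * n)) * Π + - 1# * (s * (iN * n) * Π)
        ≡⟨ KS.solve 7 (λ s i j p n m π →
             s KS.:* (i KS.:* j KS.:* (p KS.:* n)) KS.:* π KS.:+ m KS.:* (s KS.:* (j KS.:* n) KS.:* π)
             KS.:= s KS.:* (j KS.:* n) KS.:* ((p KS.:* i KS.:+ m) KS.:* π)) refl s iP iN p n (- 1#) Π ⟩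
      s * (iN * n) * ((p * iP + - 1#) * Π) ∎
      where
      open ≡-Reasoning
      s = fromℕ ∣ S ∣
      p = fromℕ ∣ P ∣
      n = fromℕ ∣ N ∣
      iN = indicator (divides N G)
      iP = indicator (divides P G)
      Π = Product (localFactor G) Ps
      ⊠⊥ : ∀ {A B Qs} → All (λ Q → Comaximal A Q) Qs → All (λ Q → Comaximal B Q) Qs →
           All (λ Q → Comaximal (A ⊠ B) Q) Qs
      ⊠⊥ as bs = All.zipWith
        (λ (a , b) → comaximal-sym (comaximal-⊠ʳ (comaximal-sym a) (comaximal-sym b))) (as , bs)
      H≈₀ : H ≈ C ⊠ (P ⊠ prod Ps ⊠ (N ⊠ S))
      H≈₀ = ≈-trans H≈ (⊠-congʳ C (⊠-cong {B = N ⊠ S} (prod-∷ P Ps) ≈-refl))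
      H≈₁ : H ≈ C ⊠ (prod Ps ⊠ (P ⊠ N ⊠ S))
      H≈₁ = ≈-trans H≈₀ (PS.solve 5 (λ c p π n s → c PS.:* (p PS.:* π PS.:* (n PS.:* s))
              PS.:= c PS.:* (π PS.:* (p PS.:* n PS.:* s))) ≈-refl C P (prod Ps) N S)
      H≈₂ : H ≈ C ⊠ P ⊠ (prod Ps ⊠ (N ⊠ S))
      H≈₂ = ≈-trans H≈₀ (PS.solve 5 (λ c p π n s → c PS.:* (p PS.:* π PS.:* (n PS.:* s))
              PS.:= c PS.:* p PS.:* (π PS.:* (n PS.:* s))) ≈-refl C P (prod Ps) N S)
      C≉0 : ¬ C ≈ []
      C≉0 = factorˡ-nonzero {C} (≈-sym H≈₀) H≉0
      P≉0 : ¬ P ≈ []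
      P≉0 = MonicIrreducible.nonzero irr
      N≉0 : ¬ N ≈ []
      N≉0 = factorˡ-nonzero {N} {S} ≈-refl
        (factorʳ-nonzero {C ⊠ P ⊠ prod Ps} {N ⊠ S}
          (≈-trans (⊠-assoc (C ⊠ P) (prod Ps) (N ⊠ S)) (≈-sym H≈₂)) H≉0)
      split : ∀ D → indicator (divides C D) * sieved (P ∷ Ps) D ≡
        indicator (divides C D) * sieved Ps D + - 1# * (indicator (divides (C ⊠ P) D) * sieved Ps D)
      split D = begin
        c * (indicator (not (divides P D) ∧ r) * e)
          ≡⟨ cong (λ x → c * (x * e)) (indicator-not-∧ (divides P D) r) ⟩
        c * ((indicator r + - 1# * (indicator (divides P D) * indicator r)) * e)
          ≡⟨ KS.solve 5 (λ c r i e m →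
               c KS.:* ((r KS.:+ m KS.:* (i KS.:* r)) KS.:* e)
               KS.:= c KS.:* (r KS.:* e) KS.:+ m KS.:* (c KS.:* i KS.:* (r KS.:* e)))
               refl c (indicator r) (indicator (divides P D)) e (- 1#) ⟩
        c * (indicator r * e) + - 1# * (c * indicator (divides P D) * (indicator r * e))
          ≡⟨ cong (λ x → c * (indicator r * e) + - 1# * (x * (indicator r * e)))
               (sym (indicator-divides-⊠ D C≉0 P≉0 C⊥P)) ⟩
        c * (indicator r * e) + - 1# * (indicator (divides (C ⊠ P) D) * (indicator r * e)) ∎
        where
        c = indicator (divides C D)
        r = all (λ Q → not (divides Q D)) Ps
        e = ψt H≉0 (G ⊠ S ⊠ D)

  η-star : ∀ {H} G → ¬ H ≈ [] →
    η (G ⊗ star H) H ≡ fromℕ ∣ star H ∣ * Product (localFactor G) (monicIrrDivisors H)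
  η-star {H} G H≉0 = begin
    Sum (filterᵇ (λ D → coprime D H) (allOfLength (deg H))) (E (G ⊗ S) H)
      ≡⟨ Sum-filter (λ D → coprime D H) (E (G ⊗ S) H) (allOfLength (deg H)) ⟩
    Σ< (deg H) (λ D → indicator (coprime D H) * E (G ⊗ S) H D)
      ≡⟨ Σ<-cong (deg H) (λ D → trans
           (cong₂ (λ b x → indicator b * x) (coprime⇔no-common-irreducible H≉0 D) (E≡ D))
           (sym (trans (cong (_* sieved H≉0 G S L D) (indicator-true (divides-one D))) (K.*-identityˡ _)))) ⟩
    Σ< (deg H) (λ D → indicator (divides one D) * sieved H≉0 G S L D)
      -- At the start all primes are still in the list: divisibility by `one` is vacuous, and
      -- `rad H` is by definition the product of `L`.
      ≡⟨ sieve H≉0 G S L one one (monicIrrDivisors-irreducible H)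
           (irreducibleDivisors-comaximal (deg H) H) one⊥ one⊥ H≈ ⟩
    fromℕ ∣ S ∣ * (indicator (divides one G) * fromℕ ∣ one ∣) * Product (localFactor G) L
      ≡⟨ cong (_* Product (localFactor G) L) (trans (cong (fromℕ ∣ S ∣ *_) unit) (K.*-identityʳ _)) ⟩
    fromℕ ∣ S ∣ * Product (localFactor G) L ∎
    where
    open ≡-Reasoning
    S = star H
    L = monicIrrDivisors H
    E≡ : ∀ D → E (G ⊗ S) H D ≡ ψt H≉0 (G ⊠ S ⊠ D)
    E≡ D = ψt-cong H≉0 (≈-trans (norm-≈ (G ⊗ S ⊠ D)) (⊠-cong {B = D} (norm-≈ (G ⊠ S)) ≈-refl))
    one⊥ : All (λ P → Comaximal one P) L
    one⊥ = All.universal (λ P → comaximal-sym comaximal-oneʳ) L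
    H≈ : H ≈ one ⊠ (rad H ⊠ (one ⊠ S))
    H≈ = ≈-sym (≈-trans (⊠-identityˡ _) (≈-trans (⊠-congʳ (rad H) (⊠-identityˡ S))
           (≈-trans (⊠-comm (rad H) S) (star⊠rad H≉0))))
    unit : indicator (divides one G) * fromℕ ∣ one ∣ ≡ 1#
    unit = trans (cong₂ _*_ (indicator-true (divides-one G)) (cong (λ d → fromℕ (𝔽.q ℕ.^ d)) deg-one))
      (trans (K.*-identityˡ _) (K.+-identityʳ 1#))

  fromℤ-neg : ∀ z → fromℤ (ℤ.- z) ≡ - fromℤ z
  fromℤ-neg (ℤ.+ zero)  = sym K.-0#≈0#
  fromℤ-neg ℤ.+[1+ n ]  = refl
  fromℤ-neg ℤ.-[1+ n ]  = sym (K.-‿involutive _)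

  -- One sign per prime: the Möbius value is distributed over the factors, turning each
  -- `|P| [P ∣ G] - 1` into its negative.
  sign-Product : ∀ f Ps →
    fromℤ ((ℤ.- ℤ.1ℤ) ℤ.^ length Ps) * Product f Ps ≡ Product (λ P → - f P) Ps
  sign-Product f [] = trans (K.*-identityʳ _) (K.+-identityʳ 1#)
  sign-Product f (P ∷ Ps) = begin
    fromℤ ((ℤ.- ℤ.1ℤ) ℤ.* z) * (f P * x)  ≡⟨ cong (λ y → fromℤ y * (f P * x)) (ℤ.-1*i≡-i z) ⟩
    fromℤ (ℤ.- z) * (f P * x)             ≡⟨ cong (_* (f P * x)) (fromℤ-neg z) ⟩
    - fromℤ z * (f P * x)                 ≡⟨ K.-‿distribˡ-* _ _ ⟨
    - (fromℤ z * (f P * x))               ≡⟨ cong -_ (KS.solve 3 (λ z y x → z KS.:* (y KS.:* x) KS.:= y KS.:* (z KS.:* x)) refl (fromℤ z) (f P) x) ⟩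
    - (f P * (fromℤ z * x))               ≡⟨ K.-‿distribˡ-* _ _ ⟩
    - f P * (fromℤ z * x)                 ≡⟨ cong (- f P *_) (sign-Product f Ps) ⟩
    - f P * Product (λ P → - f P) Ps      ∎
    where
    open ≡-Reasoning
    z = (ℤ.- ℤ.1ℤ) ℤ.^ length Ps
    x = Product f Ps

  Product-filter : ∀ p f Ps → Product f (filterᵇ p Ps) ≡ Product (λ P → if p P then f P else 1#) Ps
  Product-filter p f [] = refl
  Product-filter p f (P ∷ Ps) with p P
  ... | true  = cong (f P *_) (Product-filter p f Ps)
  ... | false = trans (Product-filter p f Ps) (sym (K.*-identityˡ _))

  Product-cong : ∀ {f g} → (∀ P → f P ≡ g P) → ∀ Ps → Product f Ps ≡ Product g Ps
  Product-cong eq []       = refl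
  Product-cong eq (P ∷ Ps) = cong₂ _*_ (eq P) (Product-cong eq Ps)

  -- Formally a product over the primes of `H`, but the factor at `P` is 1 unless `P` also divides
  -- `G`.
  commonFactor : Pol → Pol → Carrier
  commonFactor G H = Product (λ P → - localFactor G P) (monicIrrDivisors H)

  -- With the common cut-off `deg G + deg H` both products run over the same list of monic
  -- polynomials, those excluded by a filter contributing 1, and symmetry can be checked one factor
  -- at a time.
  commonFactor-sym : ∀ {G H} → ¬ G ≈ [] → ¬ H ≈ [] → commonFactor G H ≡ commonFactor H G
  commonFactor-sym {G} {H} G≉0 H≉0 = begin
    Product (λ P → - localFactor G P) (monicIrrDivisors H)
      ≡⟨ cong (Product _) (irreducibleDivisors-stable H≉0 (ℕ.m≤n+m (deg H) (deg G))) ⟨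
    Product (λ P → - localFactor G P) (irreducibleDivisors n H)
      ≡⟨ Product-filter (λ P → irreducible P ∧ divides P H) _ (monicOfDeg1to n) ⟩
    Product (λ P → if irreducible P ∧ divides P H then - localFactor G P else 1#) (monicOfDeg1to n)
      ≡⟨ Product-cong (λ P → symmetric (irreducible P) (divides P H) (divides P G) (fromℕ ∣ P ∣)) (monicOfDeg1to n) ⟩
    Product (λ P → if irreducible P ∧ divides P G then - localFactor H P else 1#) (monicOfDeg1to n)
      ≡⟨ Product-filter (λ P → irreducible P ∧ divides P G) _ (monicOfDeg1to n) ⟨
    Product (λ P → - localFactor H P) (irreducibleDivisors n G)
      ≡⟨ cong (Product _) (irreducibleDivisors-stable G≉0 (ℕ.m≤m+n (deg G) (deg H))) ⟩
    Product (λ P → - localFactor H P) (monicIrrDivisors G) ∎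
    where
    open ≡-Reasoning
    n = deg G ℕ.+ deg H
    trivial : ∀ x → - (x * 0# + - 1#) ≡ 1#
    trivial x = trans (cong -_ (trans (cong (_+ - 1#) (K.zeroʳ x)) (K.+-identityˡ _))) (K.-‿involutive 1#)
    symmetric : ∀ i h g x → (if i ∧ h then - (x * indicator g + - 1#) else 1#) ≡
                            (if i ∧ g then - (x * indicator h + - 1#) else 1#)
    symmetric false _     _     x = refl
    symmetric true  false false x = refl
    symmetric true  false true  x = sym (trivial x)
    symmetric true  true  false x = trivial x
    symmetric true  true  true  x = refl

  -- The enumeration of the finite field contains `0#`, so `q` and its powers are positive;
  -- characteristic zero keeps their images nonzero. This justifies the division by the norm of
  -- `star H`.
  fromℕ-norm≢0 : ∀ A → fromℕ ∣ A ∣ ≢ 0#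
  fromℕ-norm≢0 A with 𝔽.q ℕ.^ deg A | ℕ.m^n>0 𝔽.q ⦃ q-nonZero ⦄ (deg A)
    where
    q-nonZero : ℕ.NonZero 𝔽.q
    q-nonZero with 𝔽.elements | 𝔽.complete 𝔽.0#
    ... | _ ∷ _ | _ = _
  ... | suc n | _ = charZero n

  μη-star : ∀ {H} G → ¬ H ≈ [] →
    (fromℤ (μ (rad H)) * η (G ⊗ star H) H) /ℕ ∣ star H ∣ ≡ commonFactor G H
  μη-star {H} G H≉0 = begin
    m * η (G ⊗ star H) H * s ⁻¹
      ≡⟨ cong (λ x → m * x * s ⁻¹) (η-star G H≉0) ⟩
    m * (s * Π) * s ⁻¹
      ≡⟨ KS.solve 4 (λ m s π i → m KS.:* (s KS.:* π) KS.:* i KS.:= (s KS.:* i) KS.:* (m KS.:* π)) refl m s Π (s ⁻¹) ⟩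
    s * s ⁻¹ * (m * Π)
      ≡⟨ cong (_* (m * Π)) (inverseʳ s (fromℕ-norm≢0 (star H))) ⟩
    1# * (m * Π)
      ≡⟨ K.*-identityˡ _ ⟩
    m * Π
      ≡⟨ cong (λ z → fromℤ z * Π) (μ-rad H≉0) ⟩
    fromℤ ((ℤ.- ℤ.1ℤ) ℤ.^ length (monicIrrDivisors H)) * Π
      ≡⟨ sign-Product (localFactor G) (monicIrrDivisors H) ⟩
    commonFactor G H ∎
    where
    open ≡-Reasoning
    m = fromℤ (μ (rad H))
    s = fromℕ ∣ star H ∣
    Π = Product (localFactor G) (monicIrrDivisors H)

theorem3p1 : (𝔽 : FiniteField) (𝕂 : CharZeroField) (χ : AddChar 𝔽 𝕂)
    (G H : List (FiniteField.Carrier 𝔽)) →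
    Poly.norm 𝔽 G ≢ [] → Poly.norm 𝔽 H ≢ [] →
    let open Ramanujan 𝔽 𝕂 χ
        open CharZeroField 𝕂
    in (fromℤ (μ (rad H)) * η (G ⊗ star H) H) /ℕ ∣ star H ∣
       ≡ (fromℤ (μ (rad G)) * η (H ⊗ star G) G) /ℕ ∣ star G ∣
theorem3p1 𝔽 𝕂 χ G H G≢0 H≢0 =
  trans (μη-star G H≉0) (trans (commonFactor-sym G≉0 H≉0) (sym (μη-star H G≉0)))
  where
  open ProductFormula 𝔽 𝕂 χ
  open PolynomialRing 𝔽
  open EuclideanDivision 𝔽
  G≉0 : ¬ G ≈ []
  G≉0 p = G≢0 (norm-zero G p)
  H≉0 : ¬ H ≈ []
  H≉0 p = H≢0 (norm-zero H p)
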